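{- Let $d,k\in\mathbb{N}$, let $(n_i)_{i\ge1}$ be a sequence of $d$-admissible numbers with $\lim_{i\to\infty}n_i=\infty$, and let $X_i$ be a $(d,k,n_i)$-random Steiner complex. For each $i$ fix a $(d-1)$-face $\sigma_i$ of $X_i$ (i.e. a $d$-element subset of $[n_i]$). Then for every $r>0$, \[ \lim_{i\to\infty}\mathbb{P}\big(X_i(\sigma_i,r)\cong T_{d,k}(r)\big)=1, \] where $\cong$ denotes simplicial isomorphism.
   Context: $d$-admissible: $n\ge d+1$ with $d-j\mid\binom{n-j-1}{d-j-1}$ for all $0\le j\le d-1$. $(n,d)$-Steiner system: family of $(d+1)$-subsets of $[n]$ containing every $d$-subset of $[n]$ in exactly one member. $(d,k,n)$-random Steiner complex: the complex on $[n]$ consisting of all subsets of size $\le d$ together with $S_1\cup\dots\cup S_k$, $S_j$ i.i.d. uniformly random $(n,d)$-Steiner systems. For a $d$-complex $X$, the line graph $G_d(X)$ has vertex set $X^{d-1}$ (the $(d-1)$-faces) with $\sigma,\sigma'$ adjacent iff $\sigma\ne\sigma'$ and $\sigma\cup\sigma'\in X^d$; $B_r(\sigma_0,X)$ is the ball of radius $r$ around $\sigma_0$ in its graph metric. The $r$-neighbouring complex $X(\sigma_0,r)$ is the subcomplex $Y$ with $Y^{d-1}=B_r(\sigma_0,X)$, $Y^d=\{\tau\in X^d:\text{all }(d-1)\text{ -faces of }\tau\text{ lie in }Y^{d-1}\}$, and, for $\ell<d-1$, $Y^\ell=\{\eta\in X^\ell:\eta\subseteq\sigma\text{ for some }\sigma\in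 Y^{d-1}\}$. The arboreal complex $T_{d,k}$ is built by starting with a single $d$-face, attaching to each of its $(d-1)$-faces $k-1$ new $d$-faces, each using a new vertex, and then inductively attaching $k-1$ new $d$-faces (each with a new vertex) to each $(d-1)$-face created in the previous step; every $(d-1)$-face of $T_{d,k}$ has degree $k$. Since $T_{d,k}$ is transitive on $(d-1)$-faces, $T_{d,k}(r)$ denotes $T_{d,k}(\sigma,r)$ for any $(d-1)$-face $\sigma$ (well-defined up to isomorphism). A simplicial isomorphism is a bijection of vertex sets inducing a bijection of faces. -}

module Defs where

open import Data.Nat using (ℕ; zero; suc; _+_; _*_; _∸_; _^_; _≤_; _<_; _≡ᵇ_)
open import Data.Nat.Divisibility using (_∣_)
open import Data.Nat.Combinatorics using (_C_)
open import Data.Bool using (Bool; true; false; _∧_; _∨_; not)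
open import Data.Fin using (Fin)
open import Data.Fin.Subset using (Subset; ⁅_⁆; _∪_; ∣_∣) renaming (⊥ to ∅)
open import Data.List using (List; []; _∷_; _++_; map; length; filterᵇ; foldr; cartesianProduct; tail)
open import Data.List.Membership.Propositional using (_∈_)
open import Data.List.Relation.Unary.Unique.Propositional using (Unique)
open import Data.List.Relation.Unary.All using (All)
open import Data.Vec using (Vec; tabulate; _[_]≔_; toList)
open import Data.Product using (Σ; ∃; ∃-syntax; _×_; _,_)
open import Data.Sum using (_⊎_)
open import Data.Unit using (⊤)
open import Data.Fin using (zero; suc)
open import Relation.Binary.PropositionalEquality using (_≡_; _≢_)
open import Relation.Nullary using (¬_)
open import Function.Bundles using (_⇔_)

Admissible : ℕ → ℕ → Set
Admissible d n =
  suc d ≤ n × (∀ j → j < d → (d ∸ j) ∣ ((n ∸ j ∸ 1) C (d ∸ j ∸ 1)))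

allSubsets : ∀ n → List (Subset n)
allSubsets zero    = Data.Vec.[] ∷ []
allSubsets (suc n) = map (false Data.Vec.∷_) (allSubsets n) ++ map (true Data.Vec.∷_) (allSubsets n)

allᵇ : ∀ {A : Set} → (A → Bool) → List A → Bool
allᵇ p []       = true
allᵇ p (x ∷ xs) = p x ∧ allᵇ p xs

_⊆ᵇ_ : ∀ {n} → Subset n → Subset n → Bool
Data.Vec.[] ⊆ᵇ Data.Vec.[] = true
(x Data.Vec.∷ xs) ⊆ᵇ (y Data.Vec.∷ ys) = (not x ∨ y) ∧ (xs ⊆ᵇ ys)

-- A family of subsets of [n], i.e. an arbitrary function Subset n → Bool,
-- stored as a binary trie (so that distinct families are distinct values).
Family : ℕ → Set
Family zero    = Bool
Family (suc n) = Family n × Family n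

_∈F_ : ∀ {n} → Subset n → Family n → Bool
_∈F_ {zero}  Data.Vec.[] b = b
_∈F_ {suc n} (false Data.Vec.∷ s) (F₀ , F₁) = s ∈F F₀
_∈F_ {suc n} (true  Data.Vec.∷ s) (F₀ , F₁) = s ∈F F₁

allFamilies : ∀ n → List (Family n)
allFamilies zero    = false ∷ true ∷ []
allFamilies (suc n) = cartesianProduct (allFamilies n) (allFamilies n)

isSteiner : (d : ℕ) → ∀ {n} → Family n → Bool
isSteiner d {n} F =
  allᵇ (λ t → not (t ∈F F) ∨ (∣ t ∣ ≡ᵇ suc d)) (allSubsets n)
  ∧ allᵇ (λ s → not (∣ s ∣ ≡ᵇ d)
               ∨ (length (filterᵇ (λ t → (t ∈F F) ∧ (s ⊆ᵇ t)) (allSubsets n)) ≡ᵇ 1))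
        (allSubsets n)

numSteiner : ℕ → ℕ → ℕ
numSteiner d n = length (filterᵇ (isSteiner d) (allFamilies n))

-- Abstract simplicial complexes: a vertex type and a predicate on finite
-- lists of vertices (a face is a duplicate-free list; all predicates used
-- below only depend on the underlying set of the list).

record Cx : Set₁ where
  field
    V    : Set
    Face : List V → Set
open Cx public

module _ (X : Cx) where

  SameSet : List (V X) → List (V X) → Set
  SameSet s t = ∀ x → (x ∈ s) ⇔ (x ∈ t)

  _⊆ₗ_ : List (V X) → List (V X) → Set
  s ⊆ₗ t = ∀ x → x ∈ s → x ∈ t

  FaceCard : ℕ → List (V X) → Set
  FaceCard c s = Face X s × Unique s × length s ≡ c

  Adj : ℕ → List (V X) → List (V X) → Set
  Adj d σ σ' = FaceCard d σ × FaceCard d σ' × ¬ SameSet σ σ'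
             × ∃[ τ ] (FaceCard (suc d) τ × (∀ x → (x ∈ τ) ⇔ (x ∈ σ ⊎ x ∈ σ')))

  Ball : ℕ → ℕ → List (V X) → List (V X) → Set
  Ball d zero    σ₀ σ = FaceCard d σ × SameSet σ₀ σ
  Ball d (suc r) σ₀ σ = Ball d r σ₀ σ ⊎ ∃[ σ' ] (Ball d r σ₀ σ' × Adj d σ' σ)

  Nbr : ℕ → ℕ → List (V X) → Cx
  Nbr d r σ₀ = record
    { V    = V X
    ; Face = λ s →
        (FaceCard d s × Ball d r σ₀ s)
        ⊎ (FaceCard (suc d) s × (∀ σ → FaceCard d σ → σ ⊆ₗ s → Ball d r σ₀ σ))
        ⊎ (Face X s × Unique s × length s < d × ∃[ σ ] (Ball d r σ₀ σ × s ⊆ₗ σ))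
    }

-- simplicial isomorphism: a bijection between the vertex sets (vertices =
-- v with [v] a face) inducing a bijection of faces
_≅_ : Cx → Cx → Set
Y ≅ Z = Σ (V Y → V Z) λ f → Σ (V Z → V Y) λ g →
    ((∀ v → Face Y (v ∷ []) → Face Z (f v ∷ []) × g (f v) ≡ v)
  × (∀ w → Face Z (w ∷ []) → Face Y (g w ∷ []) × f (g w) ≡ w)
  × (∀ s → All (λ v → Face Y (v ∷ [])) s → Face Y s ⇔ Face Z (map f s)))

toSubset : ∀ {n} → List (Fin n) → Subset n
toSubset = foldr (λ x s → ⁅ x ⁆ ∪ s) ∅

SteinerCx : (d : ℕ) → ∀ {n k} → Vec (Family n) k → Cx
SteinerCx d {n} {k} S = record
  { V    = Fin n
  ; Face = λ s → Unique s ×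
      (length s ≤ d ⊎ (length s ≡ suc d × ∃[ j ] (toSubset s ∈F Data.Vec.lookup S j ≡ true)))
  }

-- The arboreal complex T_{d,k}.
-- A d-face is encoded by the path of attachments leading to it from the
-- initial d-face (most recent step first). A step (p , c) takes the current
-- d-face (an ordered (d+1)-tuple of vertices), removes the vertex at
-- position p (i.e. picks the (d-1)-face opposite to it) and glues the c-th
-- of the k-1 new d-faces on it, whose new vertex takes position p.
-- Consecutive steps must use different positions (one never re-attaches to
-- the (d-1)-face one came from).

Step : ℕ → ℕ → Set
Step d k = Fin (suc d) × Fin (k ∸ 1)

data TV (d k : ℕ) : Set where
  root : Fin (suc d) → TV d k
  new  : Step d k → List (Step d k) → TV d k

faceVec : ∀ {d k} → List (Step d k) → Vec (TV d k) (suc d)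
faceVec []              = tabulate root
faceVec ((p , c) ∷ ps)  = faceVec ps [ p ]≔ new (p , c) ps

ValidPath : ∀ d k → List (Step d k) → Set
ValidPath d k []                     = ⊤
ValidPath d k (_ ∷ [])               = ⊤
ValidPath d k (x ∷ y ∷ ps)           = Data.Product.proj₁ x ≢ Data.Product.proj₁ y × ValidPath d k (y ∷ ps)

Arboreal : ℕ → ℕ → Cx
Arboreal d k = record
  { V    = TV d k
  ; Face = λ s → Unique s × ∃[ π ] (ValidPath d k π × (∀ x → x ∈ s → x ∈ toList (faceVec {d} {k} π)))
  }

rootRidge : ∀ d k → List (TV d k)
rootRidge d k = toList (tabulate {n = d} (λ i → root (suc i)))

Tball : ℕ → ℕ → ℕ → Cx
Tball d k r = Nbr (Arboreal d k) d r (rootRidge d k)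

{-# OPTIONS --safe #-}

-- The ball around σ is explored along the arboreal complex: a path π of attachments is followed
-- in X using, for its last face, the system number colour π, and apex S π is the vertex reached.
-- Local surjectivity is automatic, because in each system a ridge lies in exactly one block, so
-- X(σ,r) ≅ T(r) as soon as apex is injective on the finitely many valid paths of length ≤ r + 1.
-- Explore them one at a time, keeping the invariant that the vertices seen so far are distinct,
-- that the vertices reachable in one more step lie outside them, and that those reachable through
-- the same system are distinct. Let p be the vertex just reached, through the system number i.
-- By the Steiner property only blocks through p of a system j ≠ i can break the invariant.
-- Exchanging p with an arbitrary unseen x inside the system number j alone changes neither the
-- past of the exploration nor p, and x is bad for the new system, which happens for boundedly
-- many x only. Double counting the pairs (S , x) bounds the proportion of bad tuples S by a
-- constant over n.

module Submission where

open import Defs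
open import Data.Bool using (Bool; true; false; _∧_; _∨_; not; T?)
import Data.Bool as 𝔹
open import Data.Empty using (⊥)
open import Data.Fin using (Fin; zero; suc; punchIn; punchOut)
import Data.Fin.Properties as Finₚ
open import Data.Fin.Permutation.Components using (transpose)
open import Data.Fin.Subset using (Subset; ⁅_⁆; _∪_; ∣_∣) renaming (_∈_ to _∈ₛ_; _∉_ to _∉ₛ_; _⊆_ to _⊆ₛ_)
import Data.Fin.Subset.Properties as Subₚ
open import Data.List using (List; []; _∷_; _++_; map; length; filter; filterᵇ; allFin; concatMap; cartesianProduct; cartesianProductWith)
import Data.List as List
import Data.List.Membership.DecPropositional as DecMembership
open import Data.List.Membership.Propositional using (_∈_; _∉_; find; lose)
import Data.List.Membership.Propositional.Properties as ∈ₚ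
import Data.List.Properties as Listₚ
open import Data.List.Relation.Unary.All using (All; []; _∷_)
import Data.List.Relation.Unary.All as All
import Data.List.Relation.Unary.All.Properties as Allₚ
open import Data.List.Relation.Unary.AllPairs using ([]; _∷_)
open import Data.List.Relation.Unary.Any using (here; there)
open import Data.List.Relation.Unary.Unique.Propositional using (Unique)
import Data.List.Relation.Unary.Unique.Propositional.Properties as Uniqueₚ
open import Data.Nat using (ℕ; zero; suc; _+_; _*_; _∸_; _^_; _≤_; _<_; _≡ᵇ_; z≤n; s≤s)
import Data.Nat.Properties as ℕₚ
open import Data.Product using (Σ; ∃-syntax; _×_; _,_; proj₁; proj₂)
import Data.Product.Properties as Productₚ
open import Data.Sum using (_⊎_; inj₁; inj₂; [_,_]′)
import Data.Sum as Sum
open import Data.Vec using (Vec; lookup; tabulate; toList; _[_]≔_)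
import Data.Vec as Vec
import Data.Vec.Properties as Vecₚ
import Data.Vec.Relation.Unary.All as VAll
import Data.Vec.Relation.Unary.All.Properties as VAllₚ
open import Function using (_∘_; id)
open import Function.Bundles using (_⇔_; mk⇔; Equivalence)
open import Relation.Binary.PropositionalEquality using (_≡_; _≢_; refl; sym; trans; cong; cong₂; subst)
open import Relation.Nullary using (¬_; Dec; yes; no; does; contradiction)
open import Relation.Nullary.Decidable using (¬?; _×-dec_; _⊎-dec_; dec-true; dec-false)
open import Relation.Unary using (Decidable)

open Equivalence using (to; from)

-- Uniformity enters through symmetry alone: relabelling the points permutes the Steiner systems,
-- and by independence one system of the tuple may be relabelled without the others. With S′ for `S`
-- after the exchange of `p` and `x` in the system `j`, the counting map is (S , x) ↦ (S′ , x). It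
-- is injective because `p` was reached through a system other than `j`: it is still the vertex
-- reached in S′, so S′ and `x` determine the transposition and hence `S`. This explains why the
-- invariant compares reachable vertices of one system only: each new way to violate it then
-- concerns a single system `j`, and one switch controls it. A vertex reachable through two systems
-- is ruled out later, when one of its paths is explored. Only boundedly many x are bad because a
-- block of the system `j` that contains x, d - 1 further points of the last face and a forbidden
-- vertex `e` is already determined by `e` and those d - 1 points; so `e` gives x back. The list of
-- paths is fixed before n and the systems, hence all bounds depend on d, k and r only.

module _ {A : Set} where

  unique-∷ : ∀ {x : A} {xs} → x ∉ xs → Unique xs → Unique (x ∷ xs)
  unique-∷ x∉ u = Allₚ.¬Any⇒All¬ _ x∉ ∷ u

  -- Induction on xs, deleting its head from ys, avoids decidable equality.
  unique-⊆⇒length≤ : ∀ {xs ys : List A} → Unique xs → (∀ {x} → x ∈ xs → x ∈ ys) → length xs ≤ length ys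
  unique-⊆-length⇒⊇ : ∀ {xs ys : List A} → Unique xs → (∀ {x} → x ∈ xs → x ∈ ys) →
    length ys ≤ length xs → ∀ {y} → y ∈ ys → y ∈ xs

  private
    drop-mid : ∀ {x : A} as {bs y} → y ∈ as ++ x ∷ bs → y ≡ x ⊎ y ∈ as ++ bs
    drop-mid as y∈ with ∈ₚ.∈-++⁻ as y∈
    ... | inj₁ y∈as = inj₂ (∈ₚ.∈-++⁺ˡ y∈as)
    ... | inj₂ (here y≡x) = inj₁ y≡x
    ... | inj₂ (there y∈bs) = inj₂ (∈ₚ.∈-++⁺ʳ as y∈bs)

    tail-⊆ : ∀ {x : A} {xs} as {bs} → Unique (x ∷ xs) → (∀ {z} → z ∈ x ∷ xs → z ∈ as ++ x ∷ bs) →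
      ∀ {z} → z ∈ xs → z ∈ as ++ bs
    tail-⊆ as u sub z∈ with drop-mid as (sub (there z∈))
    ... | inj₁ refl = contradiction z∈ (Uniqueₚ.Unique[x∷xs]⇒x∉xs u)
    ... | inj₂ z∈′ = z∈′

    length-mid : ∀ {x : A} as bs → length (as ++ x ∷ bs) ≡ suc (length (as ++ bs))
    length-mid [] bs = refl
    length-mid (_ ∷ as) bs = cong suc (length-mid as bs)

  unique-⊆⇒length≤ [] _ = z≤n
  unique-⊆⇒length≤ {x ∷ _} u@(_ ∷ u′) sub with ∈ₚ.∈-∃++ (sub (here refl))
  ... | as , bs , refl = subst (_ ≤_) (sym (length-mid as bs)) (s≤s (unique-⊆⇒length≤ u′ (tail-⊆ as u sub)))

  unique-⊆-length⇒⊇ {[]} {_ ∷ _} _ _ () _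
  unique-⊆-length⇒⊇ {x ∷ _} u@(_ ∷ u′) sub len y∈ with ∈ₚ.∈-∃++ (sub (here refl))
  ... | as , bs , refl with drop-mid as y∈
  ...   | inj₁ refl = here refl
  ...   | inj₂ y∈′ = there (unique-⊆-length⇒⊇ u′ (tail-⊆ as u sub)
                       (ℕₚ.≤-pred (subst (_≤ _) (length-mid as bs) len)) y∈′)

  unique-constant⇒length≡1 : ∀ {x : A} {xs} → Unique xs → x ∈ xs → (∀ {y} → y ∈ xs → y ≡ x) → length xs ≡ 1
  unique-constant⇒length≡1 {x} u x∈ eq =
    ℕₚ.≤-antisym (unique-⊆⇒length≤ {ys = x ∷ []} u (here ∘ eq))
                 (unique-⊆⇒length≤ {xs = x ∷ []} (unique-∷ (λ ()) []) λ { (here refl) → x∈ })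

  length≡1⇒constant : ∀ {x y : A} {xs} → length xs ≡ 1 → x ∈ xs → y ∈ xs → x ≡ y
  length≡1⇒constant {xs = _ ∷ []} _ (here refl) (here refl) = refl

  ∈-toList⁺ : ∀ {m} (v : Vec A m) i → lookup v i ∈ toList v
  ∈-toList⁺ (x Vec.∷ v) zero = here refl
  ∈-toList⁺ (x Vec.∷ v) (suc i) = there (∈-toList⁺ v i)

  ∈-toList⁻ : ∀ {m} (v : Vec A m) {x} → x ∈ toList v → ∃[ i ] x ≡ lookup v i
  ∈-toList⁻ (x Vec.∷ v) (here eq) = zero , eq
  ∈-toList⁻ (x Vec.∷ v) (there x∈) with ∈-toList⁻ v x∈
  ... | i , eq = suc i , eq

  search : (A → Bool) → List A → A → A
  search p [] a = a
  search p (x ∷ xs) a with p x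
  ... | true = x
  ... | false = search p xs a

  search-correct : ∀ (p : A → Bool) {x} xs a → x ∈ xs → p x ≡ true → p (search p xs a) ≡ true
  search-correct p (y ∷ ys) a x∈ px with p y in eq
  ... | true = eq
  search-correct p (y ∷ ys) a (here refl) px | false = contradiction (trans (sym eq) px) λ ()
  search-correct p (y ∷ ys) a (there x∈) px | false = search-correct p ys a x∈ px

  search-cong : ∀ {p q : A → Bool} → (∀ x → p x ≡ q x) → ∀ xs a → search p xs a ≡ search q xs a
  search-cong p≗q [] a = refl
  search-cong {p} {q} p≗q (x ∷ xs) a with p x | q x | p≗q x
  ... | true | true | _ = refl
  ... | false | false | _ = search-cong p≗q xs a

  allᵇ⁻ : ∀ {p : A → Bool} {xs} → allᵇ p xs ≡ true → ∀ {x} → x ∈ xs → p x ≡ true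
  allᵇ⁻ {p} {y ∷ ys} h x∈ with p y in eq
  allᵇ⁻ {p} {y ∷ ys} h (here refl) | true = eq
  allᵇ⁻ {p} {y ∷ ys} h (there x∈) | true = allᵇ⁻ {p} h x∈

  allᵇ⁺ : ∀ {p : A → Bool} xs → (∀ x → p x ≡ true) → allᵇ p xs ≡ true
  allᵇ⁺ [] h = refl
  allᵇ⁺ (x ∷ xs) h rewrite h x = allᵇ⁺ xs h

  ∈-filterᵇ⁺ : ∀ {p : A → Bool} {x xs} → x ∈ xs → p x ≡ true → x ∈ filterᵇ p xs
  ∈-filterᵇ⁺ x∈ px = ∈ₚ.∈-filter⁺ _ x∈ (subst 𝔹.T (sym px) _)

  ∈-filterᵇ⁻ : ∀ {p : A → Bool} {x} xs → x ∈ filterᵇ p xs → p x ≡ true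
  ∈-filterᵇ⁻ {p} {x} xs x∈ with p x | proj₂ (∈ₚ.∈-filter⁻ (T? ∘ p) {xs = xs} x∈)
  ... | true | _ = refl

∧-true : ∀ {a b} → a ∧ b ≡ true → a ≡ true × b ≡ true
∧-true {true} {true} _ = refl , refl

implies-true : ∀ {a b} → not a ∨ b ≡ true → a ≡ true → b ≡ true
implies-true {true} h refl = h

implies-intro : ∀ {a b} → (a ≡ true → b ≡ true) → not a ∨ b ≡ true
implies-intro {true} h = h refl
implies-intro {false} h = refl

≡ᵇ-true⇒≡ : ∀ {a b} → (a ≡ᵇ b) ≡ true → a ≡ b
≡ᵇ-true⇒≡ {a} h = ℕₚ.≡ᵇ⇒≡ a _ (subst 𝔹.T (sym h) _)

≡⇒≡ᵇ-true : ∀ {a b} → a ≡ b → (a ≡ᵇ b) ≡ true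
≡⇒≡ᵇ-true {zero} refl = refl
≡⇒≡ᵇ-true {suc a} refl = ≡⇒≡ᵇ-true {a} refl

-- Subsets and duplicate-free lists

module _ {n : ℕ} where

  ∈-toSubset⁺ : ∀ {x} {l : List (Fin n)} → x ∈ l → x ∈ₛ toSubset l
  ∈-toSubset⁺ {l = y ∷ l} (here refl) = Subₚ.x∈p∪q⁺ {p = ⁅ y ⁆} (inj₁ (Subₚ.x∈⁅x⁆ y))
  ∈-toSubset⁺ {l = y ∷ l} (there x∈) = Subₚ.x∈p∪q⁺ {p = ⁅ y ⁆} (inj₂ (∈-toSubset⁺ x∈))

  ∈-toSubset⁻ : ∀ {x} (l : List (Fin n)) → x ∈ₛ toSubset l → x ∈ l
  ∈-toSubset⁻ [] x∈ = contradiction x∈ Subₚ.∉⊥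
  ∈-toSubset⁻ (y ∷ l) x∈ with Subₚ.x∈p∪q⁻ ⁅ y ⁆ (toSubset l) x∈
  ... | inj₁ x∈y = here (Subₚ.x∈⁅y⁆⇒x≡y y x∈y)
  ... | inj₂ x∈l = there (∈-toSubset⁻ l x∈l)

  toSubset-cong : ∀ {l l′ : List (Fin n)} → (∀ {x} → x ∈ l → x ∈ l′) → (∀ {x} → x ∈ l′ → x ∈ l) →
    toSubset l ≡ toSubset l′
  toSubset-cong {l} {l′} f g = Subₚ.⊆-antisym (∈-toSubset⁺ ∘ f ∘ ∈-toSubset⁻ l) (∈-toSubset⁺ ∘ g ∘ ∈-toSubset⁻ l′)

  elems : Subset n → List (Fin n)
  elems s = filter (Subₚ._∈? s) (allFin n)

  elems-unique : ∀ s → Unique (elems s)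
  elems-unique s = Uniqueₚ.filter⁺ (Subₚ._∈? s) (Uniqueₚ.allFin⁺ n)

  toSubset-elems : ∀ s → toSubset (elems s) ≡ s
  toSubset-elems s = Subₚ.⊆-antisym
    (λ x∈ → proj₂ (∈ₚ.∈-filter⁻ (Subₚ._∈? s) {xs = allFin n} (∈-toSubset⁻ (elems s) x∈)))
    (λ x∈ → ∈-toSubset⁺ (∈ₚ.∈-filter⁺ (Subₚ._∈? s) (∈ₚ.∈-allFin _) x∈))

∣insert∣ : ∀ {n} x (s : Subset n) → x ∉ₛ s → ∣ ⁅ x ⁆ ∪ s ∣ ≡ suc ∣ s ∣
∣insert∣ zero (true Vec.∷ s) x∉ = contradiction Vec.here x∉
∣insert∣ zero (false Vec.∷ s) x∉ = cong (suc ∘ ∣_∣) (Subₚ.∪-identityˡ s)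
∣insert∣ (suc x) (true Vec.∷ s) x∉ = cong suc (∣insert∣ x s (x∉ ∘ Vec.there))
∣insert∣ (suc x) (false Vec.∷ s) x∉ = ∣insert∣ x s (x∉ ∘ Vec.there)

∣toSubset∣ : ∀ {n} {l : List (Fin n)} → Unique l → ∣ toSubset l ∣ ≡ length l
∣toSubset∣ {n} {[]} _ = Subₚ.∣⊥∣≡0 n
∣toSubset∣ {l = x ∷ l} u@(_ ∷ u′) =
  trans (∣insert∣ x (toSubset l) (Uniqueₚ.Unique[x∷xs]⇒x∉xs u ∘ ∈-toSubset⁻ l)) (cong suc (∣toSubset∣ u′))

⊆∧∣≥∣⇒⊇ : ∀ {n} {p q : Subset n} → p ⊆ₛ q → ∣ q ∣ ≤ ∣ p ∣ → q ⊆ₛ p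
⊆∧∣≥∣⇒⊇ {p = p} p⊆q le {x} x∈q with x Subₚ.∈? p
... | yes x∈p = x∈p
... | no x∉p = contradiction le (ℕₚ.<⇒≱ (Subₚ.p⊂q⇒∣p∣<∣q∣ (p⊆q , x , x∈q , x∉p)))

one-point-extension : ∀ {n} {s t : Subset n} → s ⊆ₛ t → ∣ t ∣ ≡ suc ∣ s ∣ → ∃[ v ] (v ∉ₛ s × t ≡ ⁅ v ⁆ ∪ s)
one-point-extension {s = s} {t} s⊆t eq with Finₚ.any? (λ v → (v Subₚ.∈? t) ×-dec ¬? (v Subₚ.∈? s))
... | no none = contradiction (Subₚ.p⊆q⇒∣p∣≤∣q∣ t⊆s) (ℕₚ.<⇒≱ (subst (∣ s ∣ <_) (sym eq) (ℕₚ.n<1+n _)))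
  where
  t⊆s : t ⊆ₛ s
  t⊆s {x} x∈t with x Subₚ.∈? s
  ... | yes x∈s = x∈s
  ... | no x∉s = contradiction (x , x∈t , x∉s) none
... | yes (v , v∈t , v∉s) = v , v∉s , Subₚ.⊆-antisym
    (⊆∧∣≥∣⇒⊇ sub (ℕₚ.≤-reflexive (trans eq (sym (∣insert∣ v s v∉s))))) sub
  where
  sub : ⁅ v ⁆ ∪ s ⊆ₛ t
  sub x∈ with Subₚ.x∈p∪q⁻ ⁅ v ⁆ s x∈
  ... | inj₁ x∈v rewrite Subₚ.x∈⁅y⁆⇒x≡y v x∈v = v∈t
  ... | inj₂ x∈s = s⊆t x∈s

allSubsets-complete : ∀ {n} (s : Subset n) → s ∈ allSubsets n
allSubsets-complete Vec.[] = here refl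
allSubsets-complete (false Vec.∷ s) = ∈ₚ.∈-++⁺ˡ (∈ₚ.∈-map⁺ _ (allSubsets-complete s))
allSubsets-complete (true Vec.∷ s) = ∈ₚ.∈-++⁺ʳ (map _ (allSubsets _)) (∈ₚ.∈-map⁺ _ (allSubsets-complete s))

allSubsets-unique : ∀ n → Unique (allSubsets n)
allSubsets-unique zero = [] ∷ []
allSubsets-unique (suc n) = Uniqueₚ.++⁺
  (Uniqueₚ.map⁺ (Vecₚ.∷-injectiveʳ) (allSubsets-unique n))
  (Uniqueₚ.map⁺ (Vecₚ.∷-injectiveʳ) (allSubsets-unique n))
  λ { (p , q) → disj p q }
  where
  disj : ∀ {s} → s ∈ map (false Vec.∷_) (allSubsets n) → ¬ (s ∈ map (true Vec.∷_) (allSubsets n))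
  disj p q with ∈ₚ.∈-map⁻ _ p | ∈ₚ.∈-map⁻ _ q
  ... | _ , _ , refl | _ , _ , ()

⊆ᵇ⇒⊆ : ∀ {n} {s t : Subset n} → (s ⊆ᵇ t) ≡ true → s ⊆ₛ t
⊆ᵇ⇒⊆ {s = true Vec.∷ s} {true Vec.∷ t} h Vec.here = Vec.here
⊆ᵇ⇒⊆ {s = x Vec.∷ s} {y Vec.∷ t} h (Vec.there p) = Vec.there (⊆ᵇ⇒⊆ (proj₂ (∧-true {not x ∨ y} h)) p)

⊆⇒⊆ᵇ : ∀ {n} {s t : Subset n} → s ⊆ₛ t → (s ⊆ᵇ t) ≡ true
⊆⇒⊆ᵇ {s = Vec.[]} {Vec.[]} h = refl
⊆⇒⊆ᵇ {s = false Vec.∷ s} {_ Vec.∷ t} h = ⊆⇒⊆ᵇ (Subₚ.drop-∷-⊆ h)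
⊆⇒⊆ᵇ {s = true Vec.∷ s} {_ Vec.∷ t} h with Vec.here ← h Vec.here = ⊆⇒⊆ᵇ (Subₚ.drop-∷-⊆ h)

-- Families

family-ext : ∀ {n} {F G : Family n} → (∀ s → s ∈F F ≡ s ∈F G) → F ≡ G
family-ext {zero} h = h Vec.[]
family-ext {suc n} h = cong₂ _,_ (family-ext (h ∘ (false Vec.∷_))) (family-ext (h ∘ (true Vec.∷_)))

tabulateF : ∀ {n} → (Subset n → Bool) → Family n
tabulateF {zero} f = f Vec.[]
tabulateF {suc n} f = tabulateF (f ∘ (false Vec.∷_)) , tabulateF (f ∘ (true Vec.∷_))

∈F-tabulateF : ∀ {n} (f : Subset n → Bool) s → s ∈F tabulateF f ≡ f s
∈F-tabulateF f Vec.[] = refl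
∈F-tabulateF f (false Vec.∷ s) = ∈F-tabulateF (f ∘ (false Vec.∷_)) s
∈F-tabulateF f (true Vec.∷ s) = ∈F-tabulateF (f ∘ (true Vec.∷_)) s

allFamilies-complete : ∀ {n} (F : Family n) → F ∈ allFamilies n
allFamilies-complete {zero} false = here refl
allFamilies-complete {zero} true = there (here refl)
allFamilies-complete {suc n} (F , G) = ∈ₚ.∈-cartesianProduct⁺ (allFamilies-complete F) (allFamilies-complete G)

allFamilies-unique : ∀ n → Unique (allFamilies n)
allFamilies-unique zero = unique-∷ (λ { (here ()) }) (unique-∷ (λ ()) [])
allFamilies-unique (suc n) = Uniqueₚ.cartesianProduct⁺ (allFamilies-unique n) (allFamilies-unique n)

-- Steiner systems in terms of duplicate-free lists

Block : ∀ {n} → Family n → List (Fin n) → Set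
Block F l = toSubset l ∈F F ≡ true

record Steiner (d : ℕ) {n : ℕ} (F : Family n) : Set where
  field
    size   : ∀ {l} → Unique l → Block F l → length l ≡ suc d
    cover  : ∀ {l} → Unique l → length l ≡ d → ∃[ v ] (v ∉ l × Block F (v ∷ l))
    unique : ∀ {l v w} → Unique l → length l ≡ d → v ∉ l → w ∉ l → Block F (v ∷ l) → Block F (w ∷ l) → v ≡ w

module _ {d n : ℕ} {F : Family n} where

  isSteiner⇒Steiner : isSteiner d F ≡ true → Steiner d F
  isSteiner⇒Steiner h = record { size = size′ ; cover = cover′ ; unique = unique′ }
    where
    card : ∀ t → t ∈F F ≡ true → ∣ t ∣ ≡ suc d
    card t t∈ = ≡ᵇ-true⇒≡ (implies-true (allᵇ⁻ (proj₁ (∧-true h)) (allSubsets-complete t)) t∈)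

    Over : Subset n → Subset n → Bool
    Over s t = (t ∈F F) ∧ (s ⊆ᵇ t)

    one : ∀ s → ∣ s ∣ ≡ d → length (filterᵇ (Over s) (allSubsets n)) ≡ 1
    one s eq = ≡ᵇ-true⇒≡ (implies-true (allᵇ⁻ (proj₂ (∧-true h)) (allSubsets-complete s)) (≡⇒≡ᵇ-true eq))

    size′ : ∀ {l} → Unique l → Block F l → length l ≡ suc d
    size′ {l} u b = trans (sym (∣toSubset∣ u)) (card _ b)

    cover′ : ∀ {l} → Unique l → length l ≡ d → ∃[ v ] (v ∉ l × Block F (v ∷ l))
    cover′ {l} u len with filterᵇ (Over (toSubset l)) (allSubsets n) | one (toSubset l) (trans (∣toSubset∣ u) len)
                        | (λ t → ∈-filterᵇ⁻ {p = Over (toSubset l)} {t} (allSubsets n))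
    ... | [] | () | _
    ... | _ ∷ _ ∷ _ | () | _
    ... | t ∷ [] | _ | mem with ∧-true (mem t (here refl))
    ... | t∈ , sub with one-point-extension {s = toSubset l} (⊆ᵇ⇒⊆ sub)
                          (trans (card t t∈) (cong suc (sym (trans (∣toSubset∣ u) len))))
    ... | v , v∉ , refl = v , v∉ ∘ ∈-toSubset⁺ , t∈

    unique′ : ∀ {l v w} → Unique l → length l ≡ d → v ∉ l → w ∉ l → Block F (v ∷ l) → Block F (w ∷ l) → v ≡ w
    unique′ {l} {v} {w} u len v∉ w∉ bv bw with ∈-toSubset⁻ (w ∷ l) (subst (v ∈ₛ_) eq (∈-toSubset⁺ {l = v ∷ l} (here refl)))
      where
      over : ∀ x → Block F (x ∷ l) → toSubset (x ∷ l) ∈ filterᵇ (Over (toSubset l)) (allSubsets n)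
      over x bx = ∈-filterᵇ⁺ (allSubsets-complete _)
        (cong₂ _∧_ bx (⊆⇒⊆ᵇ {s = toSubset l} λ y∈ → ∈-toSubset⁺ {l = x ∷ l} (there (∈-toSubset⁻ l y∈))))
      eq : toSubset (v ∷ l) ≡ toSubset (w ∷ l)
      eq = length≡1⇒constant (one (toSubset l) (trans (∣toSubset∣ u) len)) (over v bv) (over w bw)
    ... | here v≡w = v≡w
    ... | there v∈l = contradiction v∈l v∉

  Steiner⇒isSteiner : Steiner d F → isSteiner d F ≡ true
  Steiner⇒isSteiner st = cong₂ _∧_
      (allᵇ⁺ (allSubsets n) λ t → implies-intro (≡⇒≡ᵇ-true ∘ card t))
      (allᵇ⁺ (allSubsets n) λ s → implies-intro (≡⇒≡ᵇ-true ∘ one s ∘ ≡ᵇ-true⇒≡))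
    where
    open Steiner st
    length-elems : ∀ (s : Subset n) → length (elems s) ≡ ∣ s ∣
    length-elems s = trans (sym (∣toSubset∣ (elems-unique s))) (cong ∣_∣ (toSubset-elems s))

    card : ∀ t → t ∈F F ≡ true → ∣ t ∣ ≡ suc d
    card t t∈ = trans (sym (length-elems t))
      (size (elems-unique t) (trans (cong (_∈F F) (toSubset-elems t)) t∈))

    one : ∀ s → ∣ s ∣ ≡ d → length (filterᵇ (λ t → (t ∈F F) ∧ (s ⊆ᵇ t)) (allSubsets n)) ≡ 1
    one s eq with cover (elems-unique s) (trans (length-elems s) eq)
    ... | v , v∉ , bv = unique-constant⇒length≡1 (Uniqueₚ.filter⁺ _ (allSubsets-unique n))
        (∈-filterᵇ⁺ (allSubsets-complete (⁅ v ⁆ ∪ s))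
           (cong₂ _∧_ (insert-elems v bv) (⊆⇒⊆ᵇ {s = s} λ y∈ → Subₚ.x∈p∪q⁺ {p = ⁅ v ⁆} (inj₂ y∈))))
        all-equal
      where
      insert-elems : ∀ w → Block F (w ∷ elems s) → (⁅ w ⁆ ∪ s) ∈F F ≡ true
      insert-elems w = trans (cong (λ z → (⁅ w ⁆ ∪ z) ∈F F) (sym (toSubset-elems s)))
      all-equal : ∀ {t} → t ∈ filterᵇ (λ t → (t ∈F F) ∧ (s ⊆ᵇ t)) (allSubsets n) → t ≡ ⁅ v ⁆ ∪ s
      all-equal {t} t∈ with ∧-true (∈-filterᵇ⁻ {p = λ t → (t ∈F F) ∧ (s ⊆ᵇ t)} (allSubsets n) t∈)
      ... | t∈F , sub with one-point-extension {s = s} (⊆ᵇ⇒⊆ sub) (trans (card t t∈F) (cong suc (sym eq)))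
      ... | w , w∉ , refl = cong (λ z → ⁅ z ⁆ ∪ s) (unique (elems-unique s) (trans (length-elems s) eq)
            (λ w∈ → w∉ (subst (w ∈ₛ_) (toSubset-elems s) (∈-toSubset⁺ w∈))) v∉
            (trans (cong (λ z → (⁅ w ⁆ ∪ z) ∈F F) (toSubset-elems s)) t∈F) bv)

-- Extension of a d-set to its block

module Extension {n : ℕ} (v₀ : Fin n) where

  extends : Family n → Subset n → Fin n → Bool
  extends F s v = not (does (v Subₚ.∈? s)) ∧ ((⁅ v ⁆ ∪ s) ∈F F)

  -- The search makes this total, so the exploration is defined for arbitrary tuples of families. On
  -- a Steiner system and a `d`-set the search succeeds, and the value is the point completing the
  -- block.
  ext : Family n → List (Fin n) → Fin n
  ext F l = search (extends F (toSubset l)) (allFin n) v₀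

  ext-cong : ∀ F {l l′} → (∀ {x} → x ∈ l → x ∈ l′) → (∀ {x} → x ∈ l′ → x ∈ l) → ext F l ≡ ext F l′
  ext-cong F {l} {l′} f g = cong (λ s → search (extends F s) (allFin n) v₀) (toSubset-cong {l = l} {l′} f g)

  module _ {d : ℕ} {F : Family n} (st : Steiner d F) {l : List (Fin n)} (u : Unique l) (len : length l ≡ d) where
    private
      ext-holds : extends F (toSubset l) (ext F l) ≡ true
      ext-holds with Steiner.cover st u len
      ... | v , v∉ , bv = search-correct (extends F (toSubset l)) (allFin n) v₀ (∈ₚ.∈-allFin v)
              (cong₂ _∧_ (cong not (dec-false (v Subₚ.∈? toSubset l) (v∉ ∘ ∈-toSubset⁻ l))) bv)

    ext-∉ : ext F l ∉ l
    ext-∉ e∈ with ext F l Subₚ.∈? toSubset l | ext-holds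
    ... | no e∉ | _ = e∉ (∈-toSubset⁺ e∈)

    ext-block : Block F (ext F l ∷ l)
    ext-block = proj₂ (∧-true ext-holds)

    ext-unique : ∀ {v} → v ∉ l → Block F (v ∷ l) → v ≡ ext F l
    ext-unique v∉ bv = Steiner.unique st u len v∉ ext-∉ bv ext-block

-- Action of an involution of [n] on families

module Action {n : ℕ} (τ : Fin n → Fin n) (τ-inv : ∀ x → τ (τ x) ≡ x) where

  -- Literally the preimage of `s`; it is also the image, because `τ` is an involution.
  permS : Subset n → Subset n
  permS s = tabulate (λ i → lookup s (τ i))

  permF : Family n → Family n
  permF F = tabulateF (λ s → permS s ∈F F)

  permS-permS : ∀ s → permS (permS s) ≡ s
  permS-permS s = trans (Vecₚ.tabulate-cong (λ i → trans (Vecₚ.lookup∘tabulate _ (τ i)) (cong (lookup s) (τ-inv i))))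
    (Vecₚ.tabulate∘lookup s)

  permF-permF : ∀ F → permF (permF F) ≡ F
  permF-permF F = family-ext λ s →
    trans (∈F-tabulateF _ s) (trans (∈F-tabulateF _ (permS s)) (cong (_∈F F) (permS-permS s)))

  ∈-map-τ⁻ : ∀ {x l} → x ∈ map τ l → τ x ∈ l
  ∈-map-τ⁻ x∈ with ∈ₚ.∈-map⁻ τ x∈
  ... | y , y∈ , refl = subst (_∈ _) (sym (τ-inv y)) y∈

  map-τ-unique : ∀ {l} → Unique l → Unique (map τ l)
  map-τ-unique = Uniqueₚ.map⁺ λ {x} {y} eq → trans (sym (τ-inv x)) (trans (cong τ eq) (τ-inv y))

  permS-toSubset : ∀ l → permS (toSubset l) ≡ toSubset (map τ l)
  permS-toSubset l = Subₚ.⊆-antisym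
    (λ {x} x∈ → ∈-toSubset⁺ (subst (_∈ map τ l) (τ-inv x)
       (∈ₚ.∈-map⁺ τ (∈-toSubset⁻ l (Vecₚ.lookup⇒[]= (τ x) _ (trans (sym (Vecₚ.lookup∘tabulate _ x)) (Vecₚ.[]=⇒lookup x∈)))))))
    (λ {x} x∈ → Vecₚ.lookup⇒[]= x _ (trans (Vecₚ.lookup∘tabulate _ x)
       (Vecₚ.[]=⇒lookup (∈-toSubset⁺ {l = l} (∈-map-τ⁻ (∈-toSubset⁻ (map τ l) x∈))))))

  permF-∈F : ∀ F l → toSubset l ∈F permF F ≡ toSubset (map τ l) ∈F F
  permF-∈F F l = trans (∈F-tabulateF _ (toSubset l)) (cong (_∈F F) (permS-toSubset l))

  module _ {d : ℕ} {F : Family n} (st : Steiner d F) where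
    open Steiner st

    permF-steiner : Steiner d (permF F)
    permF-steiner = record
      { size = λ {l} u b → trans (sym (Listₚ.length-map τ l)) (size (map-τ-unique u) (trans (sym (permF-∈F F l)) b))
      ; cover = λ {l} u len → cover′ u len (cover (map-τ-unique u) (trans (Listₚ.length-map τ l) len))
      ; unique = λ {l} {v} {w} u len v∉ w∉ bv bw → trans (sym (τ-inv v)) (trans (cong τ
          (unique (map-τ-unique u) (trans (Listₚ.length-map τ l) len) (∉-map v∉) (∉-map w∉)
            (trans (sym (permF-∈F F (v ∷ l))) bv) (trans (sym (permF-∈F F (w ∷ l))) bw))) (τ-inv w))
      }
      where
      ∉-map : ∀ {v l} → v ∉ l → τ v ∉ map τ l
      ∉-map {v} {l} v∉ τv∈ = v∉ (subst (_∈ l) (τ-inv v) (∈-map-τ⁻ τv∈))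
      cover′ : ∀ {l} → Unique l → length l ≡ d → ∃[ v ] (v ∉ map τ l × Block F (v ∷ map τ l)) →
        ∃[ v ] (v ∉ l × Block (permF F) (v ∷ l))
      cover′ {l} u len (v , v∉ , bv) = τ v
        , (λ τv∈ → v∉ (subst (_∈ map τ l) (τ-inv v) (∈ₚ.∈-map⁺ τ τv∈)))
        , trans (permF-∈F F (τ v ∷ l)) (subst (λ z → Block F (z ∷ map τ l)) (sym (τ-inv v)) bv)

    module _ (v₀ : Fin n) where
      open Extension v₀

      -- Equivariance: `τ` carries the block of `F` on `map τ l` to a block of `permF F` on `l`, and
      -- there is only one such block.
      ext-permF : ∀ {l} → Unique l → length l ≡ d → ext (permF F) l ≡ τ (ext F (map τ l))
      ext-permF {l} u len = sym (ext-unique permF-steiner u len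
          (λ e∈ → ext-∉ st u′ len′ (subst (_∈ map τ l) (τ-inv _) (∈ₚ.∈-map⁺ τ e∈)))
          (trans (permF-∈F F (τ (ext F (map τ l)) ∷ l)) (subst (λ z → Block F (z ∷ map τ l)) (sym (τ-inv _)) (ext-block st u′ len′))))
        where
        u′ = map-τ-unique u
        len′ = trans (Listₚ.length-map τ l) len

-- Ridges of an ordered face

module _ {n d : ℕ} where

  ridge : Vec (Fin n) (suc d) → Fin (suc d) → List (Fin n)
  ridge v q = List.tabulate (λ i → lookup v (punchIn q i))

  length-ridge : ∀ v q → length (ridge v q) ≡ d
  length-ridge v q = Listₚ.length-tabulate (λ i → lookup v (punchIn q i))

  ∈-ridge⁺ : ∀ v {q i} → i ≢ q → lookup v i ∈ ridge v q
  ∈-ridge⁺ v {q} {i} i≢q = subst (λ z → lookup v z ∈ ridge v q) (Finₚ.punchIn-punchOut (i≢q ∘ sym))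
    (∈ₚ.∈-tabulate⁺ (punchOut (i≢q ∘ sym)))

  ∈-ridge⁻ : ∀ v {q x} → x ∈ ridge v q → ∃[ i ] (i ≢ q × x ≡ lookup v i)
  ∈-ridge⁻ v {q} x∈ with ∈ₚ.∈-tabulate⁻ x∈
  ... | i , eq = punchIn q i , Finₚ.punchInᵢ≢i q i , eq

  InjectiveOff : Fin (suc d) → Vec (Fin n) (suc d) → Set
  InjectiveOff q v = ∀ {i j} → i ≢ q → j ≢ q → lookup v i ≡ lookup v j → i ≡ j

  Injectiveᵥ : Vec (Fin n) (suc d) → Set
  Injectiveᵥ v = ∀ {i j} → lookup v i ≡ lookup v j → i ≡ j

  AgreeOff : Fin (suc d) → Vec (Fin n) (suc d) → Vec (Fin n) (suc d) → Set
  AgreeOff q v w = ∀ {i} → i ≢ q → lookup v i ≡ lookup w i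

  ridge-unique : ∀ {q v} → InjectiveOff q v → Unique (ridge v q)
  ridge-unique {q} inj = Uniqueₚ.tabulate⁺ λ {i} {j} eq →
    Finₚ.punchIn-injective q i j (inj (Finₚ.punchInᵢ≢i q i) (Finₚ.punchInᵢ≢i q j) eq)

  ridge-cong : ∀ {q v w} → AgreeOff q v w → ridge v q ≡ ridge w q
  ridge-cong {q} agree = Listₚ.tabulate-cong λ i → agree (Finₚ.punchInᵢ≢i q i)

  injective-insert : ∀ {q v} → InjectiveOff q v → lookup v q ∉ ridge v q → Injectiveᵥ v
  injective-insert {q} {v} inj ∉r {i} {j} eq with i Finₚ.≟ q | j Finₚ.≟ q
  ... | yes refl | yes refl = refl
  ... | yes refl | no j≢q = contradiction (subst (_∈ ridge v q) (sym eq) (∈-ridge⁺ v j≢q)) ∉r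
  ... | no i≢q | yes refl = contradiction (subst (_∈ ridge v q) eq (∈-ridge⁺ v i≢q)) ∉r
  ... | no i≢q | no j≢q = inj i≢q j≢q eq

-- Paths of the arboreal complex

module Paths (d k : ℕ) where

  Path : Set
  Path = List (Step d (suc k))

  Valid : Path → Set
  Valid = ValidPath d (suc k)

  -- A ridge lies in one block of each of the `suc k` systems. The `k` faces glued on a ridge take
  -- the systems other than that of the face they are glued to, which `punchIn` enumerates.
  colour : Path → Fin (suc k)
  colour [] = zero
  colour ((_ , c) ∷ π) = punchIn (colour π) c

  -- The position of the newest vertex in the face of the path.
  pos : Path → Fin (suc d)
  pos [] = zero
  pos ((p , _) ∷ _) = p

  -- A path is ready once all vertices of its base have been explored.
  data Ready (E : List Path) : Path → Set where
    start : Ready E []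
    side  : ∀ {c} → Ready E ((zero , c) ∷ [])
    child : ∀ {s π} → π ∈ E → Ready E (s ∷ π)

  Frontier : List Path → Path → Set
  Frontier E π = Valid π × π ∉ E × Ready E π

  data Explored : List Path → Set where
    []  : Explored []
    _∷_ : ∀ {π E} → Frontier E π → Explored E → Explored (π ∷ E)

  ready-there : ∀ {E π π′} → Ready E π → Ready (π′ ∷ E) π
  ready-there start = start
  ready-there side = side
  ready-there (child π∈) = child (there π∈)

  -- A step at the newest position reuses the base of `π`. Validity permits this only for the empty
  -- path, whose base is the given ridge and hence available from the start.
  ready-same-pos : ∀ {E} π {c} → Valid ((pos π , c) ∷ π) → Ready E ((pos π , c) ∷ π)
  ready-same-pos [] _ = side
  ready-same-pos (_ ∷ _) v = contradiction refl (proj₁ v)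

  explored-ready : ∀ {E π} → Explored E → π ∈ E → Ready E π
  explored-ready ((_ , _ , r) ∷ ex) (here refl) = ready-there r
  explored-ready (_ ∷ ex) (there π∈) = ready-there (explored-ready ex π∈)

  steps : List (Step d (suc k))
  steps = cartesianProduct (allFin (suc d)) (allFin k)

  steps-complete : ∀ s → s ∈ steps
  steps-complete (p , c) = ∈ₚ.∈-cartesianProduct⁺ (∈ₚ.∈-allFin p) (∈ₚ.∈-allFin c)

  readyPaths : List Path → List Path
  readyPaths E = [] ∷ map (λ c → (zero , c) ∷ []) (allFin k) ++ concatMap (λ π → map (_∷ π) steps) E

  readyPaths-complete : ∀ {E π} → Ready E π → π ∈ readyPaths E
  readyPaths-complete start = here refl
  readyPaths-complete {E} (side {c}) = there (∈ₚ.∈-++⁺ˡ (∈ₚ.∈-map⁺ _ (∈ₚ.∈-allFin c)))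
  readyPaths-complete {E} (child {s} {π} π∈) = there (∈ₚ.∈-++⁺ʳ (map (λ c → (zero , c) ∷ []) (allFin k))
    (∈ₚ.∈-concatMap⁺ (λ π → map (_∷ π) steps) (lose π∈ (∈ₚ.∈-map⁺ (_∷ π) (steps-complete s)))))

  readyPaths-sound : ∀ {E π} → π ∈ readyPaths E → Ready E π
  readyPaths-sound (here refl) = start
  readyPaths-sound {E} (there π∈) with ∈ₚ.∈-++⁻ (map (λ c → (zero , c) ∷ []) (allFin k)) π∈
  ... | inj₁ π∈′ with ∈ₚ.∈-map⁻ _ π∈′
  ...   | c , _ , refl = side
  readyPaths-sound {E} (there π∈) | inj₂ π∈′ with find (∈ₚ.∈-concatMap⁻ (λ π → map (_∷ π) steps) {xs = E} π∈′)
  ...   | π , π∈E , π∈″ with ∈ₚ.∈-map⁻ (_∷ π) π∈″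
  ...     | s , _ , refl = child π∈E

  -- Explored and invalid paths are kept: more paths only enlarge the set of values to be avoided,
  -- and the number of paths still depends on `E` alone.
  readyOf : List Path → Fin (suc k) → List Path
  readyOf E j = filter (λ π → colour π Finₚ.≟ j) (readyPaths E)

  ∈-readyOf⁺ : ∀ {E π j} → Ready E π → colour π ≡ j → π ∈ readyOf E j
  ∈-readyOf⁺ {j = j} r eq = ∈ₚ.∈-filter⁺ (λ π → colour π Finₚ.≟ j) (readyPaths-complete r) eq

  ∈-readyOf⁻ : ∀ {E π j} → π ∈ readyOf E j → Ready E π × colour π ≡ j
  ∈-readyOf⁻ {E} {j = j} π∈ with ∈ₚ.∈-filter⁻ (λ π → colour π Finₚ.≟ j) {xs = readyPaths E} π∈
  ... | π∈′ , eq = readyPaths-sound π∈′ , eq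

  -- Bounds the number of bad vertices for one system: one for each ready path, and one for each
  -- position in the last face together with a forbidden value.
  weight : List Path → ℕ
  weight E = length (readyPaths E) + suc d * (d + length E + length (readyPaths E))

  -- When at least `a` vertices are always unseen, exploring `E` discards at most the fraction
  -- `cost E` / `a` of all tuples: each new path loses at most `weight E` / `a` for each of the
  -- `suc k` systems.
  cost : List Path → ℕ
  cost [] = 0
  cost (_ ∷ E) = cost E + suc k * weight E

  private
    _≟ₚ_ : (π π′ : Path) → Dec (π ≡ π′)
    _≟ₚ_ = Listₚ.≡-dec (Productₚ.≡-dec Finₚ._≟_ Finₚ._≟_)

    valid? : ∀ π → Dec (Valid π)
    valid? [] = yes _
    valid? (_ ∷ []) = yes _
    valid? (s ∷ s′ ∷ π) = ¬? (proj₁ s Finₚ.≟ proj₁ s′) ×-dec valid? (s′ ∷ π)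

  valid-tail : ∀ s π → Valid (s ∷ π) → Valid π
  valid-tail s [] _ = _
  valid-tail s (_ ∷ _) (_ , v) = v

  explore : ∀ {E} → Explored E → ∀ cs → (∀ {π} → π ∈ cs → Ready E π) →
    ∃[ E′ ] (Explored E′ × (∀ {π} → π ∈ E → π ∈ E′) × (∀ {π} → π ∈ cs → Valid π → π ∈ E′))
  explore ex [] _ = _ , ex , id , λ ()
  explore {E} ex (c ∷ cs) ready with valid? c | c ∈? E
    where open DecMembership _≟ₚ_ using (_∈?_)
  ... | no ¬v | _ with explore ex cs (ready ∘ there)
  ...   | E′ , ex′ , sub , cov = E′ , ex′ , sub , λ { (here refl) v → contradiction v ¬v ; (there π∈) v → cov π∈ v }
  explore {E} ex (c ∷ cs) ready | yes v | yes c∈ with explore ex cs (ready ∘ there)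
  ...   | E′ , ex′ , sub , cov = E′ , ex′ , sub , λ { (here refl) _ → sub c∈ ; (there π∈) v → cov π∈ v }
  explore {E} ex (c ∷ cs) ready | yes v | no c∉
    with explore ((v , c∉ , ready (here refl)) ∷ ex) cs (ready-there ∘ ready ∘ there)
  ...   | E′ , ex′ , sub , cov = E′ , ex′ , sub ∘ there , λ { (here refl) _ → sub (here refl) ; (there π∈) v → cov π∈ v }

  -- The order of exploration is chosen here, without reference to n or to the systems; this is what
  -- makes `cost E` a constant.
  explore-ball : ∀ R → ∃[ E ] (Explored E × (∀ {π} → Valid π → length π ≤ R → π ∈ E))
  explore-ball zero = [] ∷ [] , (_ , (λ ()) , start) ∷ [] , λ { {[]} _ _ → here refl }
  explore-ball (suc R) with explore-ball R
  ... | E , ex , cov with explore ex (readyPaths E) readyPaths-sound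
  ... | E′ , ex′ , sub , cov′ = E′ , ex′ , cov″
    where
    cov″ : ∀ {π} → Valid π → length π ≤ suc R → π ∈ E′
    cov″ {[]} v _ = sub (cov v z≤n)
    cov″ {s ∷ π} v (s≤s len) = cov′ (readyPaths-complete (child (cov (valid-tail s π v) len))) v

-- The exploration of a tuple S of Steiner systems from the ridge σ: the face
-- of the arboreal complex reached by the path π is mapped to Φ S π, using a
-- block of the system number colour π.

module Exploration (d k n : ℕ) (v₀ : Fin n) (σ : Vec (Fin n) d)
  (σ-injective : ∀ {i j} → lookup σ i ≡ lookup σ j → i ≡ j) where

  open Extension v₀
  open Paths d k

  Systems : Set
  Systems = Vec (Family n) (suc k)

  AllSteiner : Systems → Set
  AllSteiner S = ∀ j → Steiner d (lookup S j)

  Φ : Systems → Path → Vec (Fin n) (suc d)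
  base : Systems → Path → List (Fin n)
  apex : Systems → Path → Fin n
  -- The last face with a hypothetical vertex in the newest position. The double counting asks
  -- whether an arbitrary unseen vertex would be bad in place of the apex.
  Ψ : Systems → Path → Fin n → Vec (Fin n) (suc d)

  Φ S π = Ψ S π (apex S π)

  base S [] = List.tabulate (lookup σ)
  base S ((p , _) ∷ π) = ridge (Φ S π) p

  apex S π = ext (lookup S (colour π)) (base S π)

  Ψ S [] e = e Vec.∷ σ
  Ψ S ((p , _) ∷ π) e = Φ S π [ p ]≔ e

  Ψ-pos : ∀ S π e → lookup (Ψ S π e) (pos π) ≡ e
  Ψ-pos S [] e = refl
  Ψ-pos S ((p , _) ∷ π) e = Vecₚ.lookup∘update p (Φ S π) e

  Ψ-agree : ∀ S π e e′ → AgreeOff (pos π) (Ψ S π e) (Ψ S π e′)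
  Ψ-agree S [] e e′ {zero} i≢ = contradiction refl i≢
  Ψ-agree S [] e e′ {suc i} i≢ = refl
  Ψ-agree S ((p , _) ∷ π) e e′ i≢ =
    trans (Vecₚ.lookup∘update′ i≢ (Φ S π) e) (sym (Vecₚ.lookup∘update′ i≢ (Φ S π) e′))

  base-ridge : ∀ S π e → base S π ≡ ridge (Ψ S π e) (pos π)
  base-ridge S [] e = refl
  base-ridge S ((p , _) ∷ π) e = ridge-cong {v = Φ S π} {Φ S π [ p ]≔ e} λ i≢ → sym (Vecₚ.lookup∘update′ i≢ (Φ S π) e)

  module _ {S : Systems} (st : AllSteiner S) where

    Φ-injective : ∀ π → Injectiveᵥ (Φ S π)
    Ψ-injectiveOff : ∀ π e → InjectiveOff (pos π) (Ψ S π e)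
    base-unique : ∀ π → Unique (base S π)
    length-base : ∀ π → length (base S π) ≡ d
    apex-∉base : ∀ π → apex S π ∉ base S π
    Ψ-injective : ∀ π {e} → e ∉ base S π → Injectiveᵥ (Ψ S π e)

    Φ-injective π = Ψ-injective π (apex-∉base π)

    Ψ-injective π {e} e∉ = injective-insert {q = pos π} {Ψ S π e} (Ψ-injectiveOff π e)
      (λ e∈ → e∉ (subst (e ∈_) (sym (base-ridge S π e)) (subst (_∈ ridge (Ψ S π e) (pos π)) (Ψ-pos S π e) e∈)))

    Ψ-injectiveOff [] e {zero} i≢ j≢ eq = contradiction refl i≢
    Ψ-injectiveOff [] e {suc i} {zero} i≢ j≢ eq = contradiction refl j≢
    Ψ-injectiveOff [] e {suc i} {suc j} i≢ j≢ eq = cong suc (σ-injective eq)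
    Ψ-injectiveOff ((p , _) ∷ π) e i≢ j≢ eq = Φ-injective π
      (trans (sym (Vecₚ.lookup∘update′ i≢ (Φ S π) e)) (trans eq (Vecₚ.lookup∘update′ j≢ (Φ S π) e)))

    base-unique π = subst Unique (sym (base-ridge S π v₀)) (ridge-unique {v = Ψ S π v₀} (Ψ-injectiveOff π v₀))

    length-base π = trans (cong length (base-ridge S π v₀)) (length-ridge (Ψ S π v₀) (pos π))

    apex-∉base π = ext-∉ (st (colour π)) (base-unique π) (length-base π)

  -- Both equations say that replacing the entry of v at q by lookup w p gives a block,
  -- grown from its ridge opposite q or from the one opposite p.
  exchange : ∀ {F : Family n} → Steiner d F → ∀ {v w p q} → q ≢ p → Injectiveᵥ v → AgreeOff p v w →
    ext F (ridge v q) ≡ lookup w p → lookup v p ≡ ext F (ridge w q)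
  exchange {F} st {v} {w} {p} {q} q≢p inj agree eq =
      ext-unique st (ridge-unique {v = w} injw) (length-ridge w q) x∉
        (trans (cong (_∈F F) (toSubset-cong sub₁ sub₂)) blk)
    where
    e = lookup w p
    e∉ : e ∉ ridge v q
    e∉ = subst (_∉ ridge v q) eq (ext-∉ st (ridge-unique {v = v} (λ _ _ → inj)) (length-ridge v q))
    blk : Block F (e ∷ ridge v q)
    blk = subst (λ z → Block F (z ∷ ridge v q)) eq (ext-block st (ridge-unique {v = v} (λ _ _ → inj)) (length-ridge v q))
    e-new : ∀ {i} → i ≢ q → i ≢ p → lookup w i ≢ e
    e-new i≢q i≢p eq′ = e∉ (subst (_∈ ridge v q) (trans (agree i≢p) eq′) (∈-ridge⁺ v i≢q))
    injw : InjectiveOff q w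
    injw {i} {j} i≢q j≢q eq′ with i Finₚ.≟ p | j Finₚ.≟ p
    ... | yes refl | yes refl = refl
    ... | yes refl | no j≢p = contradiction (sym eq′) (e-new j≢q j≢p)
    ... | no i≢p | yes refl = contradiction eq′ (e-new i≢q i≢p)
    ... | no i≢p | no j≢p = inj (trans (agree i≢p) (trans eq′ (sym (agree j≢p))))
    x∉ : lookup v p ∉ ridge w q
    x∉ x∈ with ∈-ridge⁻ w x∈
    ... | i , i≢q , eq′ with i Finₚ.≟ p
    ...   | yes refl = e∉ (subst (_∈ ridge v q) eq′ (∈-ridge⁺ v (q≢p ∘ sym)))
    ...   | no i≢p = i≢p (sym (inj (trans eq′ (sym (agree i≢p)))))
    sub₁ : ∀ {y} → y ∈ lookup v p ∷ ridge w q → y ∈ e ∷ ridge v q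
    sub₁ (here refl) = there (∈-ridge⁺ v (q≢p ∘ sym))
    sub₁ (there y∈) with ∈-ridge⁻ w y∈
    ... | i , i≢q , refl with i Finₚ.≟ p
    ...   | yes refl = here refl
    ...   | no i≢p = there (subst (_∈ ridge v q) (agree i≢p) (∈-ridge⁺ v i≢q))
    sub₂ : ∀ {y} → y ∈ e ∷ ridge v q → y ∈ lookup v p ∷ ridge w q
    sub₂ (here refl) = there (∈-ridge⁺ w (q≢p ∘ sym))
    sub₂ (there y∈) with ∈-ridge⁻ v y∈
    ... | i , i≢q , refl with i Finₚ.≟ p
    ...   | yes refl = here refl
    ...   | no i≢p = there (subst (_∈ ridge w q) (sym (agree i≢p)) (∈-ridge⁺ w i≢q))

  seen : Systems → List Path → List (Fin n)
  seen S E = toList σ ++ map (apex S) E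

  σ∈seen : ∀ S E i → lookup σ i ∈ seen S E
  σ∈seen S E i = ∈ₚ.∈-++⁺ˡ (∈-toList⁺ σ i)

  apex∈seen : ∀ S {E π} → π ∈ E → apex S π ∈ seen S E
  apex∈seen S π∈ = ∈ₚ.∈-++⁺ʳ (toList σ) (∈ₚ.∈-map⁺ (apex S) π∈)

  seen-∷⁻ : ∀ S E {π x} → x ∈ seen S (π ∷ E) → x ≡ apex S π ⊎ x ∈ seen S E
  seen-∷⁻ S E x∈ with ∈ₚ.∈-++⁻ (toList σ) x∈
  ... | inj₁ x∈σ = inj₂ (∈ₚ.∈-++⁺ˡ x∈σ)
  ... | inj₂ (here eq) = inj₁ eq
  ... | inj₂ (there x∈E) = inj₂ (∈ₚ.∈-++⁺ʳ (toList σ) x∈E)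

  length-seen : ∀ S E → length (seen S E) ≡ d + length E
  length-seen S E = trans (Listₚ.length-++ (toList σ)) (cong₂ _+_ (Vecₚ.length-toList σ) (Listₚ.length-map (apex S) E))

  module _ {E : List Path} (ex : Explored E) (S : Systems) where

    Φ∈seen : ∀ {π} → π ∈ E → ∀ i → lookup (Φ S π) i ∈ seen S E
    Ψ∈seen : ∀ {π e} → Ready E π → ∀ {i} → i ≢ pos π → lookup (Ψ S π e) i ∈ seen S E

    Φ∈seen {π} π∈ i with i Finₚ.≟ pos π
    ... | yes refl = subst (_∈ seen S E) (sym (Ψ-pos S π _)) (apex∈seen S π∈)
    ... | no i≢ = Ψ∈seen (explored-ready ex π∈) i≢

    Ψ∈seen start {zero} i≢ = contradiction refl i≢
    Ψ∈seen start {suc i} i≢ = σ∈seen S E i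
    Ψ∈seen side {zero} i≢ = contradiction refl i≢
    Ψ∈seen side {suc i} i≢ = σ∈seen S E i
    Ψ∈seen {_ ∷ π} (child π∈) {i} i≢ =
      subst (_∈ seen S E) (sym (Vecₚ.lookup∘update′ i≢ (Φ S π) _)) (Φ∈seen π∈ i)

    base∈seen : ∀ {π} → Ready E π → ∀ {x} → x ∈ base S π → x ∈ seen S E
    base∈seen {π} r x∈ with ∈-ridge⁻ (Ψ S π v₀) (subst (_ ∈_) (base-ridge S π v₀) x∈)
    ... | i , i≢ , refl = Ψ∈seen r i≢

    Ψ-ready-injective : AllSteiner S → ∀ {π x} → Ready E π → x ∉ seen S E → Injectiveᵥ (Ψ S π x)
    Ψ-ready-injective st {π} r x∉ = Ψ-injective {S} st π (x∉ ∘ base∈seen r)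

  -- In `separate`, comparing different colours would create bad events that depend on two systems
  -- at once, beyond the reach of a switch in one of them.
  record Good (E : List Path) (S : Systems) : Set where
    field
      distinct : Unique (seen S E)
      unseen   : ∀ {π} → Frontier E π → apex S π ∉ seen S E
      separate : ∀ {π π′} → Frontier E π → Frontier E π′ → colour π ≡ colour π′ → apex S π ≡ apex S π′ → π ≡ π′

  forbidden : Systems → List Path → Fin (suc k) → List (Fin n)
  forbidden S E j = seen S E ++ map (apex S) (readyOf E j)

  -- If apex S π₀ were x, a block of the system number j would cause a collision.
  Bad : List Path → Path → Fin (suc k) → Systems → Fin n → Set
  Bad E π₀ j S x = x ∈ map (apex S) (readyOf E j)
    ⊎ ∃[ q ] (q ≢ pos π₀ × ext (lookup S j) (ridge (Ψ S π₀ x) q) ∈ forbidden S E j)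

  Bad? : ∀ E π₀ j S x → Dec (Bad E π₀ j S x)
  Bad? E π₀ j S x = (x ∈? map (apex S) (readyOf E j))
      ⊎-dec Finₚ.any? λ q → ¬? (q Finₚ.≟ pos π₀) ×-dec (ext (lookup S j) (ridge (Ψ S π₀ x) q) ∈? forbidden S E j)
    where open DecMembership (Finₚ._≟_ {n}) using (_∈?_)

  -- Initially the ready paths are the empty one and the side steps, all based on the given ridge.
  -- They have pairwise different colours, so `separate` has nothing to compare.
  good-[] : ∀ {S} → AllSteiner S → Good [] S
  good-[] {S} st = record
    { distinct = subst Unique (sym (trans (Listₚ.++-identityʳ (toList σ)) toList-σ)) (Uniqueₚ.tabulate⁺ σ-injective)
    ; unseen = λ { (_ , _ , start) → λ x∈ → apex-∉base {S} st [] (seen⇒base x∈)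
              ; (_ , _ , side) → λ x∈ → apex-∉base {S} st ((zero , _) ∷ []) (seen⇒base x∈)
              ; (_ , _ , child ()) }
    ; separate = λ { (_ , _ , start) (_ , _ , start) _ _ → refl
                   ; (_ , _ , start) (_ , _ , side) () _
                   ; (_ , _ , side) (_ , _ , start) () _
                   ; (_ , _ , side) (_ , _ , side) eq _ → cong (λ c → (zero , c) ∷ []) (Finₚ.suc-injective eq)
                   ; (_ , _ , child ()) _ _ _
                   ; _ (_ , _ , child ()) _ _ }
    }
    where
    toList-tabulate : ∀ {m} (v : Vec (Fin n) m) → toList v ≡ List.tabulate (lookup v)
    toList-tabulate Vec.[] = refl
    toList-tabulate (x Vec.∷ v) = cong (x ∷_) (toList-tabulate v)
    toList-σ = toList-tabulate σ
    seen⇒base : ∀ {x} → x ∈ seen S [] → x ∈ List.tabulate (lookup σ)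
    seen⇒base = subst (_ ∈_) (trans (Listₚ.++-identityʳ (toList σ)) toList-σ)

  module _ {E : List Path} {π₀ : Path} {S : Systems} (ex : Explored E) (fr₀ : Frontier E π₀) (st : AllSteiner S)
    (good : Good E S) (fine : ∀ j → j ≢ colour π₀ → ¬ Bad E π₀ j S (apex S π₀)) where

    open Good good

    private
      data Split (π : Path) : Set where
        old   : Frontier E π → Split π
        fresh : ∀ {q c} → q ≢ pos π₀ → π ≡ (q , c) ∷ π₀ → Split π

      split : ∀ {π} → Frontier (π₀ ∷ E) π → Split π
      split (v , π∉ , start) = old (v , π∉ ∘ there , start)
      split (v , π∉ , side) = old (v , π∉ ∘ there , side)
      split (v , π∉ , child (there π∈)) = old (v , π∉ ∘ there , child π∈)
      split {(q , c) ∷ .π₀} (v , π∉ , child (here refl)) with q Finₚ.≟ pos π₀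
      ... | no q≢ = fresh q≢ refl
      ... | yes refl = old (v , π∉ ∘ there , ready-same-pos π₀ v)

      apex-fresh-∉ : ∀ {q c} → q ≢ pos π₀ → apex S ((q , c) ∷ π₀) ∉ forbidden S E (punchIn (colour π₀) c)
      apex-fresh-∉ {q} {c} q≢ e∈ = fine _ (Finₚ.punchInᵢ≢i (colour π₀) c) (inj₂ (q , q≢ , e∈))

      apex-fresh-≢ : ∀ {q c} → q ≢ pos π₀ → apex S ((q , c) ∷ π₀) ≢ apex S π₀
      apex-fresh-≢ {q} {c} q≢ eq = apex-∉base st ((q , c) ∷ π₀)
        (subst (_∈ ridge (Φ S π₀) q) (trans (Ψ-pos S π₀ _) (sym eq)) (∈-ridge⁺ (Φ S π₀) (q≢ ∘ sym)))

      -- Coincidences of equal colour are excluded by the invariant, those of different colours by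
      -- the first alternative of `Bad`.
      old-≢ : ∀ {π} → Frontier E π → π ≢ π₀ → apex S π ≢ apex S π₀
      old-≢ {π} fr π≢ eq with colour π Finₚ.≟ colour π₀
      ... | yes same = π≢ (separate fr fr₀ same eq)
      ... | no differ = fine (colour π) differ
            (inj₁ (subst (_∈ _) eq (∈ₚ.∈-map⁺ (apex S) (∈-readyOf⁺ (proj₂ (proj₂ fr)) refl))))

      -- Otherwise two distinct blocks of one system would share d points.
      fresh-fresh : ∀ {q q′ c} → apex S ((q , c) ∷ π₀) ≡ apex S ((q′ , c) ∷ π₀) → q ≡ q′
      fresh-fresh {q} {q′} {c} eq with q Finₚ.≟ q′
      ... | yes q≡q′ = q≡q′
      ... | no q≢q′ = contradiction (Φ-injective st π₀ (trans x≡ (trans (ext-cong F sub₁ sub₂) (sym y≡)))) (q≢q′ ∘ sym)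
        where
        F = lookup S (punchIn (colour π₀) c)
        stF = st (punchIn (colour π₀) c)
        v = Φ S π₀
        e = apex S ((q , c) ∷ π₀)
        agree : ∀ r → AgreeOff r v (v [ r ]≔ e)
        agree r i≢ = sym (Vecₚ.lookup∘update′ i≢ v e)
        x≡ : lookup v q′ ≡ ext F (ridge (v [ q′ ]≔ e) q)
        x≡ = exchange stF {v} {v [ q′ ]≔ e} q≢q′ (Φ-injective st π₀) (agree q′) (sym (Vecₚ.lookup∘update q′ v e))
        y≡ : lookup v q ≡ ext F (ridge (v [ q ]≔ e) q′)
        y≡ = exchange stF {v} {v [ q ]≔ e} (q≢q′ ∘ sym) (Φ-injective st π₀) (agree q)
               (trans (sym eq) (sym (Vecₚ.lookup∘update q v e)))
        sub : ∀ {r s} → r ≢ s → ∀ {x} → x ∈ ridge (v [ r ]≔ e) s → x ∈ ridge (v [ s ]≔ e) r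
        sub {r} {s} r≢s x∈ with ∈-ridge⁻ (v [ r ]≔ e) x∈
        ... | i , i≢s , refl with i Finₚ.≟ r
        ...   | yes refl = subst (_∈ ridge (v [ s ]≔ e) i)
                  (trans (Vecₚ.lookup∘update s v e) (sym (Vecₚ.lookup∘update i v e)))
                  (∈-ridge⁺ (v [ s ]≔ e) (r≢s ∘ sym))
        ...   | no i≢r = subst (_∈ ridge (v [ s ]≔ e) r)
                  (trans (sym (agree s i≢s)) (agree r i≢r)) (∈-ridge⁺ (v [ s ]≔ e) i≢r)
        sub₁ = λ {x} → sub (q≢q′ ∘ sym) {x}
        sub₂ = λ {x} → sub q≢q′ {x}

    good-∷ : Good (π₀ ∷ E) S
    good-∷ = record { distinct = distinct′ ; unseen = new′ ; separate = separate′ }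
      where
      distinct′ : Unique (seen S (π₀ ∷ E))
      distinct′ = go (toList σ) distinct (unseen fr₀)
        where
        go : ∀ as {x bs} → Unique (as ++ bs) → x ∉ as ++ bs → Unique (as ++ x ∷ bs)
        go [] u x∉ = unique-∷ x∉ u
        go (a ∷ as) {x} {bs} u@(_ ∷ u′) x∉ = unique-∷ a∉ (go as u′ (x∉ ∘ there))
          where
          a∉ : a ∉ as ++ x ∷ bs
          a∉ a∈ with ∈ₚ.∈-++⁻ as a∈
          ... | inj₁ a∈as = Uniqueₚ.Unique[x∷xs]⇒x∉xs u (∈ₚ.∈-++⁺ˡ a∈as)
          ... | inj₂ (here refl) = x∉ (here refl)
          ... | inj₂ (there a∈bs) = Uniqueₚ.Unique[x∷xs]⇒x∉xs u (∈ₚ.∈-++⁺ʳ as a∈bs)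

      new′ : ∀ {π} → Frontier (π₀ ∷ E) π → apex S π ∉ seen S (π₀ ∷ E)
      new′ fr a∈ with split fr | seen-∷⁻ S E {π₀} a∈
      ... | old fr′ | inj₁ eq = old-≢ fr′ (λ { refl → proj₁ (proj₂ fr) (here refl) }) eq
      ... | old fr′ | inj₂ a∈′ = unseen fr′ a∈′
      ... | fresh q≢ refl | inj₁ eq = apex-fresh-≢ q≢ eq
      ... | fresh q≢ refl | inj₂ a∈′ = apex-fresh-∉ q≢ (∈ₚ.∈-++⁺ˡ a∈′)

      fresh-old : ∀ {π q c} → q ≢ pos π₀ → Frontier E π → colour π ≡ punchIn (colour π₀) c →
        apex S ((q , c) ∷ π₀) ≢ apex S π
      fresh-old q≢ fr same eq = apex-fresh-∉ q≢ (∈ₚ.∈-++⁺ʳ (seen S E)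
        (subst (_∈ _) (sym eq) (∈ₚ.∈-map⁺ (apex S) (∈-readyOf⁺ (proj₂ (proj₂ fr)) same))))

      separate′ : ∀ {π π′} → Frontier (π₀ ∷ E) π → Frontier (π₀ ∷ E) π′ → colour π ≡ colour π′ →
        apex S π ≡ apex S π′ → π ≡ π′
      separate′ fr fr′ same eq with split fr | split fr′
      ... | old o | old o′ = separate o o′ same eq
      ... | fresh q≢ refl | old o = contradiction eq (fresh-old q≢ o (sym same))
      ... | old o | fresh q≢ refl = contradiction (sym eq) (fresh-old q≢ o same)
      ... | fresh q≢ refl | fresh q≢′ refl with Finₚ.punchIn-injective (colour π₀) _ _ same
      ...   | refl with fresh-fresh eq
      ...     | refl = refl

  badPositions : List Path → Path → Fin (suc k) → Systems → List (Fin n)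
  badPositions E π₀ j S = map (apex S) (readyOf E j)
    ++ concatMap (λ q → map (λ e → ext (lookup S j) (ridge (Ψ S π₀ e) q)) (forbidden S E j)) (allFin (suc d))

  length-badPositions : ∀ E π₀ j S → length (badPositions E π₀ j S) ≤ weight E
  length-badPositions E π₀ j S = begin
      length (badPositions E π₀ j S)
        ≡⟨ Listₚ.length-++ (map (apex S) (readyOf E j)) ⟩
      length (map (apex S) (readyOf E j)) + length (concatMap g (allFin (suc d)))
        ≤⟨ ℕₚ.+-mono-≤ ready≤ (length-concatMap (allFin (suc d))) ⟩
      length (readyPaths E) + length (allFin (suc d)) * (d + length E + length (readyPaths E))
        ≡⟨ cong (λ m → length (readyPaths E) + m * (d + length E + length (readyPaths E))) (Listₚ.length-tabulate {n = suc d} id) ⟩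
      weight E ∎
    where
    open ℕₚ.≤-Reasoning
    g : Fin (suc d) → List (Fin n)
    g q = map (λ e → ext (lookup S j) (ridge (Ψ S π₀ e) q)) (forbidden S E j)
    ready≤ : length (map (apex S) (readyOf E j)) ≤ length (readyPaths E)
    ready≤ = subst (_≤ length (readyPaths E)) (sym (Listₚ.length-map (apex S) (readyOf E j)))
      (Listₚ.length-filter (λ π → colour π Finₚ.≟ j) (readyPaths E))
    g≤ : ∀ q → length (g q) ≤ d + length E + length (readyPaths E)
    g≤ q = begin
      length (g q) ≡⟨ Listₚ.length-map _ (forbidden S E j) ⟩
      length (forbidden S E j) ≡⟨ Listₚ.length-++ (seen S E) ⟩
      length (seen S E) + length (map (apex S) (readyOf E j)) ≤⟨ ℕₚ.+-mono-≤ (ℕₚ.≤-reflexive (length-seen S E)) ready≤ ⟩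
      d + length E + length (readyPaths E) ∎
    length-concatMap : ∀ qs → length (concatMap g qs) ≤ length qs * (d + length E + length (readyPaths E))
    length-concatMap [] = z≤n
    length-concatMap (q ∷ qs) = subst (_≤ _) (sym (Listₚ.length-++ (g q))) (ℕₚ.+-mono-≤ (g≤ q) (length-concatMap qs))

  -- In the second alternative of `Bad` let `e` be the forbidden vertex that is hit. By `exchange`,
  -- putting `e` in place of `x` and extending the ridge opposite `q` returns `x`. So each pair of a
  -- position and a forbidden vertex accounts for a single `x`.
  bad⇒∈badPositions : ∀ {E π₀ j S x} → Explored E → AllSteiner S → Ready E π₀ → x ∉ seen S E →
    Bad E π₀ j S x → x ∈ badPositions E π₀ j S
  bad⇒∈badPositions ex st r x∉ (inj₁ x∈) = ∈ₚ.∈-++⁺ˡ x∈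
  bad⇒∈badPositions {E} {π₀} {j} {S} {x} ex st r x∉ (inj₂ (q , q≢ , e∈)) =
    ∈ₚ.∈-++⁺ʳ (map (apex S) (readyOf E j)) (∈ₚ.∈-concatMap⁺ _ (lose (∈ₚ.∈-allFin q) (subst (_∈ _)
      (trans (sym (exchange (st j) {Ψ S π₀ x} {Ψ S π₀ e} q≢ (Ψ-ready-injective ex S st r x∉) (Ψ-agree S π₀ x e)
                (sym (Ψ-pos S π₀ e)))) (Ψ-pos S π₀ x))
      (∈ₚ.∈-map⁺ _ e∈))))
    where e = ext (lookup S j) (ridge (Ψ S π₀ x) q)

  -- Changing one system by an involution that fixes everything seen so far

  module Switch {E : List Path} (ex : Explored E) {S : Systems} (st : AllSteiner S) (j : Fin (suc k))
    (τ : Fin n → Fin n) (τ-inv : ∀ x → τ (τ x) ≡ x) (τ-fix : ∀ {x} → x ∈ seen S E → τ x ≡ x) where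

    open Action τ τ-inv

    S′ : Systems
    S′ = S [ j ]≔ permF (lookup S j)

    switch-involutive : S′ [ j ]≔ permF (lookup S′ j) ≡ S
    switch-involutive = trans (Vecₚ.[]≔-idempotent S j)
      (trans (cong (S [ j ]≔_) (trans (cong permF (Vecₚ.lookup∘update j S _)) (permF-permF _))) (Vecₚ.[]≔-lookup S j))

    switch-steiner : AllSteiner S′
    switch-steiner i with i Finₚ.≟ j
    ... | yes refl = subst (Steiner d) (sym (Vecₚ.lookup∘update i S _)) (permF-steiner (st i))
    ... | no i≢j = subst (Steiner d) (sym (Vecₚ.lookup∘update′ i≢j S _)) (st i)

    private
      map-τ-fixed : ∀ {E′} → (∀ {x} → x ∈ seen S E′ → τ x ≡ x) → ∀ {l} → (∀ {x} → x ∈ l → x ∈ seen S E′) → map τ l ≡ l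
      map-τ-fixed fix {[]} _ = refl
      map-τ-fixed {E′} fix {x ∷ l} sub = cong₂ _∷_ (fix (sub (here refl))) (map-τ-fixed {E′} fix (sub ∘ there))

      Agree : List Path → Set
      Agree E′ = ∀ {π} → π ∈ E′ → apex S′ π ≡ apex S π

      module _ {E′ : List Path} (ex′ : Explored E′) (agree : Agree E′) where

        Φ-same : ∀ {π} → π ∈ E′ → Φ S′ π ≡ Φ S π
        Ψ-same : ∀ {π} → Ready E′ π → ∀ e → Ψ S′ π e ≡ Ψ S π e
        Φ-same {π} π∈ = trans (Ψ-same (explored-ready ex′ π∈) (apex S′ π)) (cong (Ψ S π) (agree π∈))
        Ψ-same start e = refl
        Ψ-same side e = refl
        Ψ-same {(p , _) ∷ _} (child π∈) e = cong (_[ p ]≔ e) (Φ-same π∈)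

        base-same : ∀ {π} → Ready E′ π → base S′ π ≡ base S π
        base-same {π} r = trans (base-ridge S′ π v₀)
          (trans (cong (λ v → ridge v (pos π)) (Ψ-same r v₀)) (sym (base-ridge S π v₀)))

        apex-other′ : ∀ {π} → Ready E′ π → colour π ≢ j → apex S′ π ≡ apex S π
        apex-other′ {π} r c≢j = cong₂ ext (Vecₚ.lookup∘update′ c≢j S _) (base-same r)

        apex-switched′ : (∀ {x} → x ∈ seen S E′ → τ x ≡ x) → ∀ {π} → Ready E′ π → colour π ≡ j → apex S′ π ≡ τ (apex S π)
        apex-switched′ fix {π} r refl = trans (cong₂ ext (Vecₚ.lookup∘update j S _) (base-same r))
          (trans (ext-permF (st j) v₀ (base-unique st π) (length-base st π))
            (cong (τ ∘ ext (lookup S j)) (map-τ-fixed {E′} fix (base∈seen ex′ S r))))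

      -- Induction along the exploration. A path of colour `j` has its apex moved by `τ`, but this
      -- apex has been seen, so `τ` fixes it; the other colours use unchanged systems on unchanged
      -- bases.
      agree-all : ∀ {E′} → Explored E′ → (∀ {π} → π ∈ E′ → π ∈ E) → Agree E′
      agree-all (_∷_ {π₀} {E′} (_ , _ , r) ex′) sub (there π∈) = agree-all ex′ (sub ∘ there) π∈
      agree-all (_∷_ {π₀} {E′} (_ , _ , r) ex′) sub (here refl) with colour π₀ Finₚ.≟ j
      ... | no c≢j = apex-other′ ex′ (agree-all ex′ (sub ∘ there)) r c≢j
      ... | yes c≡j = trans (apex-switched′ ex′ (agree-all ex′ (sub ∘ there)) fix r c≡j) (τ-fix (apex∈seen S (sub (here refl))))
        where
        fix : ∀ {x} → x ∈ seen S E′ → τ x ≡ x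
        fix x∈ with ∈ₚ.∈-++⁻ (toList σ) x∈
        ... | inj₁ x∈σ = τ-fix (∈ₚ.∈-++⁺ˡ x∈σ)
        ... | inj₂ x∈E′ with ∈ₚ.∈-map⁻ (apex S) x∈E′
        ...   | π , π∈ , refl = τ-fix (apex∈seen S (sub (there π∈)))

      agree-E : Agree E
      agree-E = agree-all ex id

    apex-other : ∀ {π} → Ready E π → colour π ≢ j → apex S′ π ≡ apex S π
    apex-other = apex-other′ ex agree-E

    apex-switched : ∀ {π} → Ready E π → colour π ≡ j → apex S′ π ≡ τ (apex S π)
    apex-switched = apex-switched′ ex agree-E τ-fix

    seen-same : seen S′ E ≡ seen S E
    seen-same = cong (toList σ ++_) (go E id)
      where
      go : ∀ E′ → (∀ {π} → π ∈ E′ → π ∈ E) → map (apex S′) E′ ≡ map (apex S) E′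
      go [] _ = refl
      go (π ∷ E′) sub = cong₂ _∷_ (agree-E (sub (here refl))) (go E′ (sub ∘ there))

    -- Badness is equivariant: `τ` fixes what has been seen, moves the ready apexes of colour `j`,
    -- and maps the hypothetical face with `τ x` to the one with `x`. For the transposition of the
    -- apex with an unseen vertex this turns badness of the apex in `S` into badness of that vertex
    -- in `S′`.
    bad-switch : ∀ {π₀ x} → Ready E π₀ → x ∉ seen S E → τ x ∉ seen S E → Bad E π₀ j S x → Bad E π₀ j S′ (τ x)
    bad-switch {π₀} {x} r x∉ τx∉ = λ
      { (inj₁ x∈) → inj₁ (ready-τ x∈)
      ; (inj₂ (q , q≢ , e∈)) → inj₂ (q , q≢ , subst (_∈ forbidden S′ E j) (sym (ext-τ q)) (forbidden-τ e∈))
      }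
      where
      ready-τ : ∀ {y} → y ∈ map (apex S) (readyOf E j) → τ y ∈ map (apex S′) (readyOf E j)
      ready-τ y∈ with ∈ₚ.∈-map⁻ (apex S) y∈
      ... | π , π∈ , refl = subst (_∈ map (apex S′) (readyOf E j))
            (apex-switched (proj₁ (∈-readyOf⁻ {E} {j = j} π∈)) (proj₂ (∈-readyOf⁻ {E} {j = j} π∈))) (∈ₚ.∈-map⁺ (apex S′) π∈)

      forbidden-τ : ∀ {y} → y ∈ forbidden S E j → τ y ∈ forbidden S′ E j
      forbidden-τ y∈ with ∈ₚ.∈-++⁻ (seen S E) y∈
      ... | inj₁ y∈E = ∈ₚ.∈-++⁺ˡ (subst (_∈ seen S′ E) (sym (τ-fix y∈E)) (subst (_ ∈_) (sym seen-same) y∈E))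
      ... | inj₂ y∈R = ∈ₚ.∈-++⁺ʳ (seen S′ E) (ready-τ y∈R)

      map-τ-Ψ : ∀ i → τ (lookup (Ψ S π₀ (τ x)) i) ≡ lookup (Ψ S π₀ x) i
      map-τ-Ψ i with i Finₚ.≟ pos π₀
      ... | yes refl = trans (cong τ (Ψ-pos S π₀ (τ x))) (trans (τ-inv x) (sym (Ψ-pos S π₀ x)))
      ... | no i≢ = trans (τ-fix (Ψ∈seen ex S r i≢)) (Ψ-agree S π₀ (τ x) x i≢)

      ext-τ : ∀ q → ext (lookup S′ j) (ridge (Ψ S′ π₀ (τ x)) q) ≡ τ (ext (lookup S j) (ridge (Ψ S π₀ x) q))
      ext-τ q = trans (cong₂ ext (Vecₚ.lookup∘update j S _) (cong (λ v → ridge v q) (Ψ-same ex agree-E r (τ x))))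
        (trans (ext-permF (st j) v₀ (ridge-unique {v = Ψ S π₀ (τ x)} (λ _ _ → Ψ-ready-injective ex S st r τx∉))
                 (length-ridge (Ψ S π₀ (τ x)) q))
          (cong (τ ∘ ext (lookup S j)) (trans (Listₚ.map-tabulate _ τ)
            (Listₚ.tabulate-cong (λ i → map-τ-Ψ (punchIn q i))))))

-- Transpositions

module _ {n : ℕ} where

  transpose-left : ∀ (i j : Fin n) → transpose i j i ≡ j
  transpose-left i j rewrite dec-true (i Finₚ.≟ i) refl = refl

  transpose-fixes : ∀ {i j k : Fin n} → k ≢ i → k ≢ j → transpose i j k ≡ k
  transpose-fixes {i} {j} {k} k≢i k≢j rewrite dec-false (k Finₚ.≟ i) k≢i | dec-false (k Finₚ.≟ j) k≢j = refl

  transpose-right : ∀ (i j : Fin n) → transpose i j j ≡ i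
  transpose-right i j with j Finₚ.≟ i
  ... | yes j≡i = j≡i
  ... | no j≢i rewrite dec-true (j Finₚ.≟ j) refl = refl

  transpose-involutive : ∀ (i j k : Fin n) → transpose i j (transpose i j k) ≡ k
  transpose-involutive i j k with k Finₚ.≟ i
  ... | yes refl = transpose-right k j
  ... | no k≢i with k Finₚ.≟ j
  ...   | yes refl = transpose-left i k
  ...   | no k≢j = transpose-fixes k≢i k≢j

-- Double counting and a union bound for lists.

module _ {X Y : Set} where

  length-filters : ∀ {P : X → Set} (P? : Decidable P) xs →
    length xs ≡ length (filter P? xs) + length (filter (¬? ∘ P?) xs)
  length-filters P? [] = refl
  length-filters P? (x ∷ xs) with P? x
  ... | yes _ = cong suc (length-filters P? xs)
  ... | no _ = trans (cong suc (length-filters P? xs)) (sym (ℕₚ.+-suc _ _))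

  -- Count the pairs (g x y , y).
  double-counting : ∀ {a c} (f : X → List Y) (g : X → Y → X) (h : X → List Y) zs →
    (∀ x → Unique (f x)) → (∀ x → a ≤ length (f x)) → (∀ z → length (h z) ≤ c) →
    ∀ {xs} → Unique xs →
    (∀ {x x′ y} → x ∈ xs → x′ ∈ xs → y ∈ f x → y ∈ f x′ → g x y ≡ g x′ y → x ≡ x′) →
    (∀ {x y} → x ∈ xs → y ∈ f x → g x y ∈ zs × y ∈ h (g x y)) →
    a * length xs ≤ c * length zs
  double-counting {a} {c} f g h zs f-unique a≤ ≤c {xs} u inj into =
      ℕₚ.≤-trans (lower xs) (ℕₚ.≤-trans (unique-⊆⇒length≤ (pairs-unique u inj) (pairs⊆ into)) (upper zs))
    where
    row : X → List (X × Y)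
    row x = map (λ y → g x y , y) (f x)
    pairs : List X → List (X × Y)
    pairs = concatMap row
    column : X → List (X × Y)
    column z = map (z ,_) (h z)

    lower : ∀ xs → a * length xs ≤ length (pairs xs)
    lower [] = ℕₚ.≤-reflexive (ℕₚ.*-zeroʳ a)
    lower (x ∷ xs) = begin
      a * suc (length xs)                  ≡⟨ ℕₚ.*-suc a _ ⟩
      a + a * length xs                    ≤⟨ ℕₚ.+-mono-≤ (a≤ x) (lower xs) ⟩
      length (f x) + length (pairs xs)     ≡⟨ cong (_+ _) (sym (Listₚ.length-map _ (f x))) ⟩
      length (row x) + length (pairs xs)   ≡⟨ sym (Listₚ.length-++ (row x)) ⟩
      length (pairs (x ∷ xs))              ∎
      where open ℕₚ.≤-Reasoning

    upper : ∀ zs → length (concatMap column zs) ≤ c * length zs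
    upper [] = z≤n
    upper (z ∷ zs) = begin
      length (concatMap column (z ∷ zs))              ≡⟨ Listₚ.length-++ (column z) ⟩
      length (column z) + length (concatMap column zs) ≡⟨ cong (_+ _) (Listₚ.length-map _ (h z)) ⟩
      length (h z) + length (concatMap column zs)     ≤⟨ ℕₚ.+-mono-≤ (≤c z) (upper zs) ⟩
      c + c * length zs                               ≡⟨ sym (ℕₚ.*-suc c _) ⟩
      c * suc (length zs)                             ∎
      where open ℕₚ.≤-Reasoning

    pairs-unique : ∀ {xs} → Unique xs →
      (∀ {x x′ y} → x ∈ xs → x′ ∈ xs → y ∈ f x → y ∈ f x′ → g x y ≡ g x′ y → x ≡ x′) → Unique (pairs xs)
    pairs-unique [] _ = []
    pairs-unique {x ∷ xs} u@(_ ∷ u′) inj =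
      Uniqueₚ.++⁺ (Uniqueₚ.map⁺ (cong proj₂) (f-unique x))
        (pairs-unique u′ (λ x∈ x′∈ → inj (there x∈) (there x′∈))) λ { (p , q) → disjoint p q }
      where
      disjoint : ∀ {w} → w ∈ row x → w ∈ pairs xs → ⊥
      disjoint p q with ∈ₚ.∈-map⁻ _ p | find (∈ₚ.∈-concatMap⁻ row {xs = xs} q)
      ... | y , y∈ , refl | x′ , x′∈ , q′ with ∈ₚ.∈-map⁻ _ q′
      ...   | y′ , y′∈ , eq with cong proj₂ eq
      ...     | refl = Uniqueₚ.Unique[x∷xs]⇒x∉xs u
                (subst (_∈ xs) (sym (inj (here refl) (there x′∈) y∈ y′∈ (cong proj₁ eq))) x′∈)

    pairs⊆ : ∀ {xs} → (∀ {x y} → x ∈ xs → y ∈ f x → g x y ∈ zs × y ∈ h (g x y)) →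
      ∀ {w} → w ∈ pairs xs → w ∈ concatMap column zs
    pairs⊆ {xs} into w∈ with find (∈ₚ.∈-concatMap⁻ row {xs = xs} w∈)
    ... | x , x∈ , w∈′ with ∈ₚ.∈-map⁻ _ w∈′
    ...   | y , y∈ , refl with into x∈ y∈
    ...     | z∈ , y∈h = ∈ₚ.∈-concatMap⁺ column (lose z∈ (∈ₚ.∈-map⁺ (g x y ,_) y∈h))

  -- A union bound, with the factor `a` kept on the left instead of dividing. The conditions are
  -- filtered out one after another, so the bound is required for every duplicate-free sublist of
  -- `L`.
  sieve : ∀ {a w} {P : Y → X → Set} (P? : ∀ i → Decidable (P i)) is L → Unique L →
    (∀ {i} → i ∈ is → ∀ {L′} → Unique L′ → (∀ {x} → x ∈ L′ → x ∈ L) → a * length (filter (P? i) L′) ≤ w) →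
    ∃[ L′ ] (Unique L′ × (∀ {x} → x ∈ L′ → x ∈ L × (∀ {i} → i ∈ is → ¬ P i x))
      × a * length L ≤ a * length L′ + length is * w)
  sieve P? [] L u _ = L , u , (λ x∈ → x∈ , λ ()) , ℕₚ.m≤m+n _ _
  sieve {a} {w} {P} P? (i ∷ is) L u bound
    with sieve {a} {w} P? is (filter (¬? ∘ P? i) L) (Uniqueₚ.filter⁺ _ u)
           (λ i∈ u′ sub → bound (there i∈) u′ (λ x∈ → proj₁ (∈ₚ.∈-filter⁻ (¬? ∘ P? i) {xs = L} (sub x∈))))
  ... | L′ , u′ , sub , le = L′ , u′ , sub′ , le′
    where
    sub′ : ∀ {x} → x ∈ L′ → x ∈ L × (∀ {i′} → i′ ∈ i ∷ is → ¬ P i′ x)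
    sub′ x∈ with sub x∈
    ... | x∈′ , none with ∈ₚ.∈-filter⁻ (¬? ∘ P? i) {xs = L} x∈′
    ...   | x∈L , ¬p = x∈L , λ { (here refl) → ¬p ; (there i∈) → none i∈ }
    le′ : a * length L ≤ a * length L′ + (w + length is * w)
    le′ = begin
      a * length L ≡⟨ cong (a *_) (length-filters (P? i) L) ⟩
      a * (length (filter (P? i) L) + length (filter (¬? ∘ P? i) L)) ≡⟨ ℕₚ.*-distribˡ-+ a (length (filter (P? i) L)) _ ⟩
      a * length (filter (P? i) L) + a * length (filter (¬? ∘ P? i) L) ≤⟨ ℕₚ.+-mono-≤ (bound (here refl) u id) le ⟩
      w + (a * length L′ + length is * w) ≡⟨ sym (ℕₚ.+-assoc w (a * length L′) _) ⟩
      w + a * length L′ + length is * w ≡⟨ cong (_+ length is * w) (ℕₚ.+-comm w _) ⟩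
      a * length L′ + w + length is * w ≡⟨ ℕₚ.+-assoc (a * length L′) w _ ⟩
      a * length L′ + (w + length is * w) ∎
      where open ℕₚ.≤-Reasoning

-- Counting the tuples of systems on which the exploration succeeds.

module Counting (d k n : ℕ) (v₀ : Fin n) (σ : Vec (Fin n) d)
  (σ-injective : ∀ {i j} → lookup σ i ≡ lookup σ j → i ≡ j)
  (U : List (Vec (Family n) (suc k)))
  (U-sound : ∀ {S} → S ∈ U → ∀ j → Steiner d (lookup S j))
  (U-complete : ∀ {S} → (∀ j → Steiner d (lookup S j)) → S ∈ U)
  (U-unique : Unique U) where

  open Paths d k
  open Exploration d k n v₀ σ σ-injective
  open DecMembership (Finₚ._≟_ {n}) using (_∈?_)

  private
    unseenPositions : List Path → Systems → List (Fin n)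
    unseenPositions E S = filter (λ x → ¬? (x ∈? seen S E)) (allFin n)

    ∈-unseen⁻ : ∀ {E S x} → x ∈ unseenPositions E S → x ∉ seen S E
    ∈-unseen⁻ {E} {S} x∈ = proj₂ (∈ₚ.∈-filter⁻ (λ x → ¬? (x ∈? seen S E)) {xs = allFin n} x∈)

    length-unseen : ∀ {a E} S → a + (d + length E) ≤ n → a ≤ length (unseenPositions E S)
    length-unseen {a} {E} S le = ℕₚ.+-cancelʳ-≤ (d + length E) a _ (ℕₚ.≤-trans le (begin
      n ≡⟨ sym (Listₚ.length-tabulate {n = n} id) ⟩
      length (allFin n) ≤⟨ unique-⊆⇒length≤ (Uniqueₚ.allFin⁺ n) split ⟩
      length (unseenPositions E S ++ seen S E) ≡⟨ Listₚ.length-++ (unseenPositions E S) ⟩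
      length (unseenPositions E S) + length (seen S E) ≡⟨ cong (length (unseenPositions E S) +_) (length-seen S E) ⟩
      length (unseenPositions E S) + (d + length E) ∎))
      where
      open ℕₚ.≤-Reasoning
      split : ∀ {x} → x ∈ allFin n → x ∈ unseenPositions E S ++ seen S E
      split {x} x∈ with x ∈? seen S E
      ... | yes x∈S = ∈ₚ.∈-++⁺ʳ (unseenPositions E S) x∈S
      ... | no x∉S = ∈ₚ.∈-++⁺ˡ (∈ₚ.∈-filter⁺ (λ x → ¬? (x ∈? seen S E)) x∈ x∉S)

  module _ {E : List Path} (ex : Explored E) {π₀ : Path} (fr₀ : Frontier E π₀) (j : Fin (suc k)) (j≢ : j ≢ colour π₀) where

    switchTo : Systems → Fin n → Systems
    switchTo S x = S [ j ]≔ Action.permF (transpose (apex S π₀) x) (transpose-involutive (apex S π₀) x) (lookup S j)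

    -- Each bad tuple is paired with its unseen vertices, at least `a` of them. After the switch the
    -- same vertex lies in `badPositions` of the new tuple, and each tuple of `U` has at most
    -- `weight E` such vertices.
    count-bad : ∀ {a} → a + (d + length E) ≤ n → ∀ {L} → Unique L → (∀ {S} → S ∈ L → S ∈ U × Good E S) →
      a * length (filter (λ S → Bad? E π₀ j S (apex S π₀)) L) ≤ weight E * length U
    count-bad {a} le {L} u good = double-counting (unseenPositions E) switchTo (badPositions E π₀ j) U
        (λ S → Uniqueₚ.filter⁺ _ (Uniqueₚ.allFin⁺ n)) (λ S → length-unseen {a} {E} S le) (length-badPositions E π₀ j)
        (Uniqueₚ.filter⁺ _ u) inj into
      where
      bads : List Systems
      bads = filter (λ S → Bad? E π₀ j S (apex S π₀)) L

      ready₀ : Ready E π₀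
      ready₀ = proj₂ (proj₂ fr₀)

      module _ {S : Systems} (S∈ : S ∈ bads) {x : Fin n} (x∈ : x ∈ unseenPositions E S) where
        S∈L×bad : S ∈ L × Bad E π₀ j S (apex S π₀)
        S∈L×bad = ∈ₚ.∈-filter⁻ (λ S → Bad? E π₀ j S (apex S π₀)) {xs = L} S∈
        st : AllSteiner S
        st = U-sound (proj₁ (good (proj₁ S∈L×bad)))
        p = apex S π₀
        p∉ : p ∉ seen S E
        p∉ = Good.unseen (proj₂ (good (proj₁ S∈L×bad))) fr₀
        x∉ : x ∉ seen S E
        x∉ = ∈-unseen⁻ {E} {S} x∈
        fixes : ∀ {y} → y ∈ seen S E → transpose p x y ≡ y
        fixes y∈ = transpose-fixes (λ { refl → p∉ y∈ }) (λ { refl → x∉ y∈ })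
        module Sw = Switch ex st j (transpose p x) (transpose-involutive p x) fixes

        apex-kept : apex (switchTo S x) π₀ ≡ p
        apex-kept = Sw.apex-other ready₀ (j≢ ∘ sym)

        -- The second switch recomputes the apex from the switched tuple. It is still `p`, since
        -- `π₀` does not have colour `j`, so the same transposition is applied twice.
        recover : switchTo (switchTo S x) x ≡ S
        recover = trans (helper apex-kept) Sw.switch-involutive
          where
          helper : ∀ {p′} → p′ ≡ p → switchTo S x [ j ]≔ Action.permF (transpose p′ x) (transpose-involutive p′ x) (lookup (switchTo S x) j)
            ≡ switchTo S x [ j ]≔ Action.permF (transpose p x) (transpose-involutive p x) (lookup (switchTo S x) j)
          helper refl = refl

        lands : switchTo S x ∈ U × x ∈ badPositions E π₀ j (switchTo S x)
        lands = U-complete Sw.switch-steiner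
          , bad⇒∈badPositions ex Sw.switch-steiner ready₀ (subst (x ∉_) (sym Sw.seen-same) x∉)
              (subst (Bad E π₀ j (switchTo S x)) (transpose-left p x)
                (Sw.bad-switch ready₀ p∉ (subst (_∉ seen S E) (sym (transpose-left p x)) x∉) (proj₂ S∈L×bad)))

      inj : ∀ {S S′ x} → S ∈ bads → S′ ∈ bads → x ∈ unseenPositions E S → x ∈ unseenPositions E S′ →
        switchTo S x ≡ switchTo S′ x → S ≡ S′
      inj {x = x} S∈ S′∈ x∈ x∈′ eq = trans (sym (recover S∈ x∈)) (trans (cong (λ T → switchTo T x) eq) (recover S′∈ x∈′))

      into : ∀ {S x} → S ∈ bads → x ∈ unseenPositions E S → switchTo S x ∈ U × x ∈ badPositions E π₀ j (switchTo S x)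
      into S∈ x∈ = lands S∈ x∈

  private
    others : Path → List (Fin (suc k))
    others π₀ = filter (λ j → ¬? (j Finₚ.≟ colour π₀)) (allFin (suc k))

    length-others : ∀ π₀ → length (others π₀) ≤ suc k
    length-others π₀ = subst (length (others π₀) ≤_) (Listₚ.length-tabulate {n = suc k} id)
      (Listₚ.length-filter (λ j → ¬? (j Finₚ.≟ colour π₀)) (allFin (suc k)))

  -- Losses are always measured against the whole of `U`, so those of the single steps add up to
  -- `cost E`. One `a` serves for all steps, because shorter explorations leave at least as many
  -- vertices unseen.
  many-good : ∀ {a E} → Explored E → a + (d + length E) ≤ n →
    ∃[ L ] (Unique L × (∀ {S} → S ∈ L → S ∈ U × Good E S) × a * length U ≤ a * length L + cost E * length U)
  many-good [] _ = U , U-unique , (λ S∈ → S∈ , good-[] (U-sound S∈)) , ℕₚ.m≤m+n _ _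
  many-good {a} {π₀ ∷ E} (fr₀ ∷ ex) le
    with le′ ← ℕₚ.≤-trans (ℕₚ.+-monoʳ-≤ a (ℕₚ.+-monoʳ-≤ d (ℕₚ.n≤1+n _))) le
    with many-good {a} ex le′
  ... | L , u , good , bound
    with sieve {a = a} {w = weight E * length U} (λ j S → Bad? E π₀ j S (apex S π₀)) (others π₀) L u
           (λ {j} j∈ u′ sub → count-bad ex fr₀ j
              (proj₂ (∈ₚ.∈-filter⁻ (λ j → ¬? (j Finₚ.≟ colour π₀)) {xs = allFin (suc k)} j∈)) {a} le′ u′ (good ∘ sub))
  ... | L′ , u′ , sub , bound′ = L′ , u′ , good′ , total
    where
    good′ : ∀ {S} → S ∈ L′ → S ∈ U × Good (π₀ ∷ E) S
    good′ S∈ with sub S∈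
    ... | S∈L , none with good S∈L
    ...   | S∈U , g = S∈U , good-∷ ex fr₀ (U-sound S∈U) g
              (λ j j≢ → none (∈ₚ.∈-filter⁺ (λ j → ¬? (j Finₚ.≟ colour π₀)) (∈ₚ.∈-allFin j) j≢))
    W = length U
    total : a * W ≤ a * length L′ + (cost E + suc k * weight E) * W
    total = begin
      a * W ≤⟨ bound ⟩
      a * length L + cost E * W ≤⟨ ℕₚ.+-monoˡ-≤ (cost E * W) bound′ ⟩
      a * length L′ + length (others π₀) * (weight E * W) + cost E * W ≡⟨ ℕₚ.+-assoc (a * length L′) _ _ ⟩
      a * length L′ + (length (others π₀) * (weight E * W) + cost E * W)
        ≤⟨ ℕₚ.+-monoʳ-≤ (a * length L′) (ℕₚ.+-monoˡ-≤ (cost E * W) (ℕₚ.*-monoˡ-≤ (weight E * W) (length-others π₀))) ⟩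
      a * length L′ + (suc k * (weight E * W) + cost E * W)
        ≡⟨ cong (a * length L′ +_) (trans (ℕₚ.+-comm _ (cost E * W)) (cong (cost E * W +_) (sym (ℕₚ.*-assoc (suc k) (weight E) W)))) ⟩
      a * length L′ + (cost E * W + suc k * weight E * W)
        ≡⟨ cong (a * length L′ +_) (sym (ℕₚ.*-distribʳ-+ W (cost E) _)) ⟩
      a * length L′ + (cost E + suc k * weight E) * W ∎
      where open ℕₚ.≤-Reasoning

-- Sublists of vectors, and blocks sharing a ridge.

module _ {A : Set} where

  indices : ∀ {m} (v : Vec A m) t → (∀ {x} → x ∈ t → x ∈ toList v) → ∃[ is ] map (lookup v) is ≡ t
  indices v [] _ = [] , refl
  indices v (x ∷ t) sub with ∈-toList⁻ v (sub (here refl)) | indices v t (sub ∘ there)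
  ... | i , refl | is , refl = i ∷ is , refl

  -- Pigeonhole on the indices of the entries of `t`: they are `m` distinct elements of
  -- `Fin (suc m)`. This turns a ridge given as an unordered list into the part of a face opposite
  -- one position.
  missed-index : ∀ {m} (v : Vec A (suc m)) {t} → Unique t → length t ≡ m → (∀ {x} → x ∈ t → x ∈ toList v) →
    ∃[ p ] ((∀ {x} → x ∈ t → ∃[ i ] (i ≢ p × x ≡ lookup v i)) × (∀ {i} → i ≢ p → lookup v i ∈ t))
  missed-index {m} v {t} u len sub with indices v t sub
  ... | is , refl = search-missing
    where
    open DecMembership (Finₚ._≟_ {suc m}) using (_∈?_)
    len-is : length is ≡ m
    len-is = trans (sym (Listₚ.length-map (lookup v) is)) len
    search-missing : ∃[ p ] ((∀ {x} → x ∈ map (lookup v) is → ∃[ i ] (i ≢ p × x ≡ lookup v i))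
      × (∀ {i} → i ≢ p → lookup v i ∈ map (lookup v) is))
    search-missing with Finₚ.any? (λ p → ¬? (p ∈? is))
    ... | no all = contradiction
          (ℕₚ.≤-trans (unique-⊆⇒length≤ (Uniqueₚ.allFin⁺ (suc m)) (λ {i} _ → everything i)) (ℕₚ.≤-reflexive len-is))
          (ℕₚ.<⇒≱ (ℕₚ.≤-reflexive (sym (Listₚ.length-tabulate {n = suc m} id))))
      where
      everything : ∀ i → i ∈ is
      everything i with i ∈? is
      ... | yes i∈ = i∈
      ... | no i∉ = contradiction (i , i∉) all
    ... | yes (p , p∉) = p , avoids , contains
      where
      avoids : ∀ {x} → x ∈ map (lookup v) is → ∃[ i ] (i ≢ p × x ≡ lookup v i)
      avoids x∈ with ∈ₚ.∈-map⁻ (lookup v) x∈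
      ... | i , i∈ , eq = i , (λ { refl → p∉ i∈ }) , eq
      contains : ∀ {i} → i ≢ p → lookup v i ∈ map (lookup v) is
      contains {i} i≢p with unique-⊆-length⇒⊇ (unique-∷ p∉ (Uniqueₚ.map⁻ u)) (λ {x} _ → ∈ₚ.∈-allFin x)
                              (ℕₚ.≤-reflexive (trans (Listₚ.length-tabulate {n = suc m} id) (cong suc (sym len-is)))) (∈ₚ.∈-allFin i)
      ... | here i≡p = contradiction i≡p i≢p
      ... | there i∈ = ∈ₚ.∈-map⁺ (lookup v) i∈

  full : ∀ {m} (v : Vec A m) {t} → Unique t → length t ≡ m → (∀ {x} → x ∈ t → x ∈ toList v) → ∀ i → lookup v i ∈ t
  full v u len sub i = unique-⊆-length⇒⊇ u sub
    (ℕₚ.≤-reflexive (trans (Vecₚ.length-toList v) (sym len))) (∈-toList⁺ v i)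

  module _ {B : Set} {f : A → B} where

    unique-map⇒injective : ∀ {xs x y} → Unique (map f xs) → x ∈ xs → y ∈ xs → f x ≡ f y → x ≡ y
    unique-map⇒injective u (here refl) (here refl) _ = refl
    unique-map⇒injective u (here refl) (there {xs = xs} y∈) eq =
      contradiction (subst (_∈ map f xs) (sym eq) (∈ₚ.∈-map⁺ f y∈)) (Uniqueₚ.Unique[x∷xs]⇒x∉xs u)
    unique-map⇒injective u (there {xs = xs} x∈) (here refl) eq =
      contradiction (subst (_∈ map f xs) eq (∈ₚ.∈-map⁺ f x∈)) (Uniqueₚ.Unique[x∷xs]⇒x∉xs u)
    unique-map⇒injective (_ ∷ u) (there x∈) (there y∈) eq = unique-map⇒injective u x∈ y∈ eq

  unique-++⇒disjoint : ∀ as {bs} {x : A} → Unique (as ++ bs) → x ∈ as → x ∉ bs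
  unique-++⇒disjoint (a ∷ as) u (here refl) x∈ = Uniqueₚ.Unique[x∷xs]⇒x∉xs u (∈ₚ.∈-++⁺ʳ as x∈)
  unique-++⇒disjoint (a ∷ as) (_ ∷ u) (there x∈as) x∈ = unique-++⇒disjoint as u x∈as x∈

  unique-++⇒right : ∀ (as : List A) {bs} → Unique (as ++ bs) → Unique bs
  unique-++⇒right [] u = u
  unique-++⇒right (_ ∷ as) (_ ∷ u) = unique-++⇒right as u

  search-∈ : ∀ p xs (a : A) → search p xs a ≡ a ⊎ search p xs a ∈ xs
  search-∈ p [] a = inj₁ refl
  search-∈ p (x ∷ xs) a with p x
  ... | true = inj₂ (here refl)
  ... | false with search-∈ p xs a
  ...   | inj₁ eq = inj₁ eq
  ...   | inj₂ x∈ = inj₂ (there x∈)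

-- Both blocks consist of `l` and its only extension. Hence a block of the complex on an explored
-- ridge is the one that the exploration follows.
blocks-coincide : ∀ {d n} {F : Family n} → Steiner d F → ∀ {l B C} → Unique l → length l ≡ d →
  Unique B → Unique C → (∀ {x} → x ∈ l → x ∈ B) → (∀ {x} → x ∈ l → x ∈ C) → Block F B → Block F C →
  ∀ {x} → x ∈ B → x ∈ C
blocks-coincide {F = F} st {l} {B} {C} u len uB uC l⊆B l⊆C bB bC {x} x∈
  with extension uB l⊆B bB | extension uC l⊆C bC
  where
  open Steiner st
  extension : ∀ {B} → Unique B → (∀ {x} → x ∈ l → x ∈ B) → Block F B →
    ∃[ v ] (v ∉ l × toSubset B ≡ toSubset (v ∷ l))
  extension {B} uB l⊆B bB with one-point-extension {s = toSubset l} {toSubset B}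
      (λ y∈ → ∈-toSubset⁺ (l⊆B (∈-toSubset⁻ l y∈)))
      (trans (∣toSubset∣ uB) (trans (size uB bB) (cong suc (trans (sym len) (sym (∣toSubset∣ u))))))
  ... | v , v∉ , eq = v , v∉ ∘ ∈-toSubset⁺ , eq
... | v , v∉ , eqB | w , w∉ , eqC
  with Steiner.unique st u len v∉ w∉ (trans (cong (_∈F F) (sym eqB)) bB) (trans (cong (_∈F F) (sym eqC)) bC)
... | refl = ∈-toSubset⁻ C (subst (x ∈ₛ_) (trans eqB (sym eqC)) (∈-toSubset⁺ x∈))

-- Vertices and faces of the arboreal complex

module Tree (d k : ℕ) where

  open Paths d k

  Vertex : Set
  Vertex = TV d (suc k)

  depth : Vertex → ℕ
  depth (root _) = 0
  depth (new _ π) = suc (length π)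

  verts : Path → Vec Vertex (suc d)
  verts = faceVec {d} {suc k}

  depth-verts : ∀ π i → depth (lookup (verts π) i) ≤ length π
  depth-verts [] i = ℕₚ.≤-reflexive (cong depth (Vecₚ.lookup∘tabulate root i))
  depth-verts ((p , c) ∷ π) i with i Finₚ.≟ p
  ... | yes refl = ℕₚ.≤-reflexive (cong depth (Vecₚ.lookup∘update i (verts π) (new (p , c) π)))
  ... | no i≢p = ℕₚ.≤-trans (ℕₚ.≤-reflexive (cong depth (Vecₚ.lookup∘update′ i≢p (verts π) (new (p , c) π))))
                   (ℕₚ.m≤n⇒m≤1+n (depth-verts π i))

  -- The two newest vertices of a face sit at different positions, so every ridge contains one of them.
  ridge-depth : ∀ {π t r} → Valid π → Unique t → length t ≡ d → (∀ {x} → x ∈ t → x ∈ toList (verts π)) →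
    (∀ {x} → x ∈ t → depth x ≤ r) → length π ≤ suc r
  ridge-depth {[]} _ _ _ _ _ = z≤n
  ridge-depth {_ ∷ []} _ _ _ _ _ = s≤s z≤n
  ridge-depth {(p , c) ∷ (q , c′) ∷ π} {t} {r} (p≢q , _) u len sub shallow
    with missed-index (verts ((p , c) ∷ (q , c′) ∷ π)) u len sub
  ... | m , _ , contains with p Finₚ.≟ m
  ...   | no p≢m = ℕₚ.m≤n⇒m≤1+n (subst (λ w → depth w ≤ r)
            (Vecₚ.lookup∘update p (verts ((q , c′) ∷ π)) _) (shallow (contains p≢m)))
  ...   | yes refl = s≤s (subst (λ w → depth w ≤ r)
            (trans (Vecₚ.lookup∘update′ (p≢q ∘ sym) (verts ((q , c′) ∷ π)) _) (Vecₚ.lookup∘update q (verts π) _))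
            (shallow (contains (p≢q ∘ sym))))

  private
    valid-recolour : ∀ q {c} c′ π → Valid ((q , c) ∷ π) → Valid ((q , c′) ∷ π)
    valid-recolour q c′ [] _ = _
    valid-recolour q c′ (_ ∷ _) v = v

  -- All `suc k` colours occur around a ridge of the arboreal complex: on the face itself and on its
  -- children, or, when `p` is the newest position of a nonempty path, on the face itself, its
  -- parent and its siblings.
  face-of-colour : ∀ {π} → Valid π → ∀ p j →
    ∃[ π′ ] (Valid π′ × colour π′ ≡ j × length π′ ≤ suc (length π) × (∀ {i} → i ≢ p → lookup (verts π′) i ≡ lookup (verts π) i))
  face-of-colour {π} v p j with colour π Finₚ.≟ j
  ... | yes eq = π , v , eq , ℕₚ.n≤1+n _ , λ _ → refl
  face-of-colour {[]} v p j | no c≢j =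
    (p , punchOut c≢j) ∷ [] , _ , Finₚ.punchIn-punchOut c≢j , ℕₚ.≤-refl , λ i≢p → Vecₚ.lookup∘update′ i≢p (verts []) _
  face-of-colour {(q , c) ∷ π} v p j | no c≢j with p Finₚ.≟ q
  ... | no p≢q = (p , punchOut c≢j) ∷ (q , c) ∷ π , (p≢q , v) , Finₚ.punchIn-punchOut c≢j , ℕₚ.≤-refl
               , λ i≢p → Vecₚ.lookup∘update′ i≢p (verts ((q , c) ∷ π)) _
  ... | yes refl with colour π Finₚ.≟ j
  ...   | yes eq = π , valid-tail (q , c) π v , eq , ℕₚ.m≤n⇒m≤1+n (ℕₚ.n≤1+n _)
                 , λ i≢p → sym (Vecₚ.lookup∘update′ i≢p (verts π) _)
  ...   | no c≢j′ = (q , punchOut c≢j′) ∷ π , valid-recolour q _ π v , Finₚ.punchIn-punchOut c≢j′ , ℕₚ.n≤1+n _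
                 , λ i≢p → trans (Vecₚ.lookup∘update′ i≢p (verts π) _) (sym (Vecₚ.lookup∘update′ i≢p (verts π) _))

-- Transport of the relations defining balls along a map

module _ {A B : Set} (g : A → B) where

  map-⊆ : ∀ {s t : List A} → (∀ {x} → x ∈ s → x ∈ t) → ∀ {y} → y ∈ map g s → y ∈ map g t
  map-⊆ sub y∈ with ∈ₚ.∈-map⁻ g y∈
  ... | x , x∈ , refl = ∈ₚ.∈-map⁺ g (sub x∈)

  same-map : ∀ {s t : List A} → (∀ x → (x ∈ s) ⇔ (x ∈ t)) → ∀ y → (y ∈ map g s) ⇔ (y ∈ map g t)
  same-map same y = mk⇔ (map-⊆ (λ {x} → to (same x))) (map-⊆ (λ {x} → from (same x)))

  union-map : ∀ {τ s t : List A} → (∀ x → (x ∈ τ) ⇔ (x ∈ s ⊎ x ∈ t)) →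
    ∀ y → (y ∈ map g τ) ⇔ (y ∈ map g s ⊎ y ∈ map g t)
  union-map {τ} {s} {t} un y = mk⇔ forth [ map-⊆ (λ {x} → from (un x) ∘ inj₁) , map-⊆ (λ {x} → from (un x) ∘ inj₂) ]′
    where
    forth : y ∈ map g τ → y ∈ map g s ⊎ y ∈ map g t
    forth y∈ with ∈ₚ.∈-map⁻ g y∈
    ... | x , x∈ , refl = Sum.map (∈ₚ.∈-map⁺ g) (∈ₚ.∈-map⁺ g) (to (un x) x∈)

-- The left inverse `h` serves the inequality of the two ridges: if their images had the same
-- elements, applying `h` would give the same for the ridges themselves.
adj-map : ∀ {X Y : Cx} {c} (g : V X → V Y) (h : V Y → V X) {s s′ τ : List (V X)} →
  map h (map g s) ≡ s → map h (map g s′) ≡ s′ →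
  FaceCard Y c (map g s) → FaceCard Y c (map g s′) → ¬ SameSet X s s′ →
  FaceCard Y (suc c) (map g τ) → (∀ x → (x ∈ τ) ⇔ (x ∈ s ⊎ x ∈ s′)) → Adj Y c (map g s) (map g s′)
adj-map g h {s} {s′} {τ} hgs hgs′ fs fs′ ¬same fτ un = fs , fs′
  , (λ same → ¬same λ x → subst (λ l → (x ∈ l) ⇔ (x ∈ s′)) hgs
       (subst (λ l → (x ∈ map h (map g s)) ⇔ (x ∈ l)) hgs′ (same-map h same x)))
  , map g τ , fτ , union-map g un

-- The exploration as a simplicial isomorphism

module Isomorphism (d k n : ℕ) (v₀ : Fin n) (σ : Vec (Fin n) d)
  (σ-injective : ∀ {i j} → lookup σ i ≡ lookup σ j → i ≡ j) (r : ℕ) where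

  open Paths d k
  open Exploration d k n v₀ σ σ-injective
  open Tree d k
  open Extension v₀

  module _ {E : List Path} (cover : ∀ {π} → Valid π → length π ≤ suc r → π ∈ E)
    {S : Systems} (st : AllSteiner S) (good : Good E S) where

    X T : Cx
    X = SteinerCx d S
    T = Arboreal d (suc k)

    σ₀ : List (Fin n)
    σ₀ = toList σ
    ρ₀ : List Vertex
    ρ₀ = rootRidge d (suc k)

    φ : Vertex → Fin n
    φ (root i) = lookup (Φ S []) i
    φ (new s π) = apex S (s ∷ π)

    φ-verts : ∀ π i → φ (lookup (verts π) i) ≡ lookup (Φ S π) i
    φ-verts [] i = cong φ (Vecₚ.lookup∘tabulate root i)
    φ-verts ((p , c) ∷ π) i with i Finₚ.≟ p
    ... | yes refl = trans (cong φ (Vecₚ.lookup∘update i (verts π) _)) (sym (Vecₚ.lookup∘update i (Φ S π) _))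
    ... | no i≢p = trans (cong φ (Vecₚ.lookup∘update′ i≢p (verts π) _))
                     (trans (φ-verts π i) (sym (Vecₚ.lookup∘update′ i≢p (Φ S π) _)))

    data Known : Vertex → Set where
      root : ∀ {i} → Known (root i)
      new  : ∀ {s π} → s ∷ π ∈ E → Known (new s π)

    known-verts : ∀ {π} → Valid π → length π ≤ suc r → ∀ i → Known (lookup (verts π) i)
    known-verts {[]} _ _ i = subst Known (sym (Vecₚ.lookup∘tabulate root i)) root
    known-verts {(p , c) ∷ π} v len i with i Finₚ.≟ p
    ... | yes refl = subst Known (sym (Vecₚ.lookup∘update i (verts π) _)) (new (cover v len))
    ... | no i≢p = subst Known (sym (Vecₚ.lookup∘update′ i≢p (verts π) _))
                     (known-verts (valid-tail (p , c) π v) (ℕₚ.≤-trans (ℕₚ.n≤1+n _) len) i)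

    private
      -- The vertex that a path adds. The empty path adds `root zero`, the only vertex of the
      -- initial face outside `rootRidge`.
      origin : Path → Vertex
      origin [] = root zero
      origin (s ∷ π) = new s π

      -- The known vertices, sorted as in the list `seen S E`, so that `distinct` yields injectivity
      -- of `φ`.
      data Seen : Vertex → Set where
        given : ∀ i → Seen (root (suc i))
        found : ∀ {π} → π ∈ E → Seen (origin π)

      seen-known : ∀ {w} → Known w → Seen w
      seen-known (root {zero}) = found {[]} (cover _ z≤n)
      seen-known (root {suc i}) = given i
      seen-known (new {s} {π} π∈) = found {s ∷ π} π∈

      φ-origin : ∀ π → φ (origin π) ≡ apex S π
      φ-origin [] = refl
      φ-origin (_ ∷ _) = refl

      σ≢apex : ∀ {i π} → π ∈ E → lookup σ i ≢ apex S π
      σ≢apex {i} π∈ eq = unique-++⇒disjoint (toList σ) (Good.distinct good) (∈-toList⁺ σ i)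
        (subst (_∈ _) (sym eq) (∈ₚ.∈-map⁺ (apex S) π∈))

      seen-injective : ∀ {u w} → Seen u → Seen w → φ u ≡ φ w → u ≡ w
      seen-injective (given i) (given j) eq = cong (λ i → root (suc i)) (σ-injective eq)
      seen-injective (given i) (found {π} π∈) eq = contradiction (trans eq (φ-origin π)) (σ≢apex π∈)
      seen-injective (found {π} π∈) (given j) eq = contradiction (trans (sym eq) (φ-origin π)) (σ≢apex π∈)
      seen-injective (found {π} π∈) (found {π′} π∈′) eq = cong origin
        (unique-map⇒injective (unique-++⇒right (toList σ) (Good.distinct good)) π∈ π∈′
          (trans (sym (φ-origin π)) (trans eq (φ-origin π′))))

      candidates : List Vertex
      candidates = map root (allFin (suc d)) ++ map origin E

      known-candidate : ∀ {w} → w ∈ candidates → Known w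
      known-candidate w∈ with ∈ₚ.∈-++⁻ (map root (allFin (suc d))) w∈
      ... | inj₁ w∈′ with ∈ₚ.∈-map⁻ root w∈′
      ...   | i , _ , refl = root
      known-candidate w∈ | inj₂ w∈′ with ∈ₚ.∈-map⁻ origin w∈′
      ...   | [] , _ , refl = root
      ...   | _ ∷ _ , π∈ , refl = new π∈

      candidate-known : ∀ {w} → Known w → w ∈ candidates
      candidate-known root = ∈ₚ.∈-++⁺ˡ (∈ₚ.∈-map⁺ root (∈ₚ.∈-allFin _))
      candidate-known (new π∈) = ∈ₚ.∈-++⁺ʳ (map root (allFin (suc d))) (∈ₚ.∈-map⁺ origin π∈)

    ψ : Fin n → Vertex
    ψ x = search (λ w → does (φ w Finₚ.≟ x)) candidates (root zero)

    ψ-φ : ∀ {w} → Known w → ψ (φ w) ≡ w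
    ψ-φ {w} kn = seen-injective (seen-known known) (seen-known kn) φψφ
      where
      test : Vertex → Bool
      test u = does (φ u Finₚ.≟ φ w)
      known : Known (ψ (φ w))
      -- The default `root zero` is itself known, so `ψ` has only known values and injectivity
      -- applies to them.
      known with search-∈ test candidates (root zero)
      ... | inj₁ eq = subst Known (sym eq) root
      ... | inj₂ w∈ = known-candidate w∈
      φψφ : φ (ψ (φ w)) ≡ φ w
      φψφ with φ (ψ (φ w)) Finₚ.≟ φ w | search-correct test candidates (root zero) (candidate-known kn) (dec-true (φ w Finₚ.≟ φ w) refl)
      ... | yes eq | _ = eq
      ... | no _ | ()

    InFace : Path → List Vertex → Set
    InFace π t = ∀ {w} → w ∈ t → w ∈ toList (verts π)

    OnFace : Path → List (Fin n) → Set
    OnFace π s = ∀ {x} → x ∈ s → ∃[ i ] x ≡ φ (lookup (verts π) i)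

    inFace-depth : ∀ {π t r′} → length π ≤ r′ → InFace π t → ∀ {w} → w ∈ t → depth w ≤ r′
    inFace-depth {π} len sub w∈ with ∈-toList⁻ (verts π) (sub w∈)
    ... | i , refl = ℕₚ.≤-trans (depth-verts π i) len

    inFace⇒onFace : ∀ {π t} → InFace π t → OnFace π (map φ t)
    inFace⇒onFace {π} sub x∈ with ∈ₚ.∈-map⁻ φ x∈
    ... | w , w∈ , refl with ∈-toList⁻ (verts π) (sub w∈)
    ...   | i , refl = i , refl

    module _ {π : Path} (v : Valid π) (len : length π ≤ suc r) where

      ψφ-list : ∀ {t} → InFace π t → map ψ (map φ t) ≡ t
      ψφ-list {[]} _ = refl
      ψφ-list {w ∷ t} sub with ∈-toList⁻ (verts π) (sub (here refl))
      ... | i , refl = cong₂ _∷_ (ψ-φ (known-verts v len i)) (ψφ-list (sub ∘ there))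

      φψ-list : ∀ {s} → OnFace π s → map φ (map ψ s) ≡ s
      φψ-list {[]} _ = refl
      φψ-list {x ∷ s} on with on (here refl)
      ... | i , refl = cong₂ _∷_ (cong φ (ψ-φ (known-verts v len i))) (φψ-list (on ∘ there))

      onFace⇒inFace : ∀ {s} → OnFace π s → InFace π (map ψ s)
      onFace⇒inFace on w∈ with ∈ₚ.∈-map⁻ ψ w∈
      ... | x , x∈ , refl with on x∈
      ...   | i , refl = subst (_∈ toList (verts π)) (sym (ψ-φ (known-verts v len i))) (∈-toList⁺ (verts π) i)

      φ-unique : ∀ {t} → InFace π t → Unique t → Unique (map φ t)
      φ-unique sub u = Uniqueₚ.map⁻ {f = ψ} (subst Unique (sym (ψφ-list sub)) u)

      ψ-unique : ∀ {s} → OnFace π s → Unique s → Unique (map ψ s)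
      ψ-unique on u = Uniqueₚ.map⁻ {f = φ} (subst Unique (sym (φψ-list on)) u)

      φ-ridge : ∀ {t} → InFace π t → Unique t → length t ≡ d → FaceCard X d (map φ t)
      φ-ridge {t} sub u l = (u′ , inj₁ (ℕₚ.≤-reflexive l′)) , u′ , l′
        where
        u′ = φ-unique sub u
        l′ = trans (Listₚ.length-map φ t) l

      ψ-face : ∀ {c s} → OnFace π s → Unique s → length s ≡ c → FaceCard T c (map ψ s)
      ψ-face {s = s} on u l = (u′ , π , v , λ _ → onFace⇒inFace on) , u′ , trans (Listₚ.length-map ψ s) l
        where u′ = ψ-unique on u

    Φ-block : ∀ π {l} → (∀ {x} → x ∈ l → ∃[ i ] x ≡ lookup (Φ S π) i) → (∀ i → lookup (Φ S π) i ∈ l) →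
      Block (lookup S (colour π)) l
    Φ-block π {l} sub sup = trans (cong (_∈F lookup S (colour π)) (toSubset-cong fwd bwd))
        (ext-block (st (colour π)) (base-unique st π) (length-base st π))
      where
      fwd : ∀ {x} → x ∈ l → x ∈ apex S π ∷ base S π
      fwd x∈ with sub x∈
      ... | i , refl with i Finₚ.≟ pos π
      ...   | yes refl = here (Ψ-pos S π _)
      ...   | no i≢ = there (subst (lookup (Φ S π) i ∈_) (sym (base-ridge S π _)) (∈-ridge⁺ (Φ S π) i≢))
      bwd : ∀ {x} → x ∈ apex S π ∷ base S π → x ∈ l
      bwd (here refl) = subst (_∈ l) (Ψ-pos S π _) (sup (pos π))
      bwd (there x∈) with ∈-ridge⁻ (Φ S π) (subst (_ ∈_) (base-ridge S π (apex S π)) x∈)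
      ... | i , _ , refl = sup i

    φ-face : ∀ {π} → Valid π → length π ≤ suc r → ∀ {t} → InFace π t → Unique t → length t ≡ suc d →
      FaceCard X (suc d) (map φ t)
    φ-face {π} v len {t} sub u l = (u′ , inj₂ (l′ , colour π , Φ-block π on all)) , u′ , l′
      where
      u′ = φ-unique v len sub u
      l′ = trans (Listₚ.length-map φ t) l
      on : ∀ {x} → x ∈ map φ t → ∃[ i ] x ≡ lookup (Φ S π) i
      on x∈ with inFace⇒onFace {π} sub x∈
      ... | i , eq = i , trans eq (φ-verts π i)
      all : ∀ i → lookup (Φ S π) i ∈ map φ t
      all i = subst (_∈ map φ t) (φ-verts π i) (∈ₚ.∈-map⁺ φ (full (verts π) u l sub i))

    -- Local surjectivity. The ridge `s` lies opposite some position `p` of the face of `π`; around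
    -- that ridge the tree has a face with the colour of the system containing `F`, and two blocks
    -- of one system on `s` coincide.
    onFace-complete : ∀ {π s F r′} → Valid π → length π ≤ r′ → r′ ≤ r → OnFace π s → FaceCard X d s →
      FaceCard X (suc d) F → (∀ {x} → x ∈ s → x ∈ F) →
      ∃[ π′ ] (Valid π′ × length π′ ≤ suc r′ × OnFace π′ F)
    onFace-complete _ _ _ _ _ ((_ , inj₁ le) , _ , l) _ = contradiction (subst (_≤ d) l le) (ℕₚ.<⇒≱ (ℕₚ.n<1+n d))
    onFace-complete {π} {s} {F} v len r′≤r on (_ , us , ls) ((_ , inj₂ (_ , j , blk)) , uF , lF) s⊆F
      with missed-index (verts π) (ψ-unique v len₁ on us) (trans (Listₚ.length-map ψ s) ls) (onFace⇒inFace v len₁ on)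
      where len₁ = ℕₚ.≤-trans len (ℕₚ.m≤n⇒m≤1+n r′≤r)
    ... | p , avoids , _ with face-of-colour v p j
    ...   | π′ , v′ , refl , len′ , same = π′ , v′ , ℕₚ.≤-trans len′ (s≤s len) , onF
      where
      len₁ : length π ≤ suc r
      len₁ = ℕₚ.≤-trans len (ℕₚ.m≤n⇒m≤1+n r′≤r)
      G : List (Fin n)
      G = List.tabulate (lookup (Φ S π′))
      s⊆G : ∀ {x} → x ∈ s → x ∈ G
      s⊆G {x} x∈ with avoids (∈ₚ.∈-map⁺ ψ x∈) | on x∈
      ... | i , i≢p , eq | i₀ , refl = subst (_∈ G) (trans (sym (φ-verts π′ i)) (cong φ (trans (same i≢p)
              (trans (sym eq) (ψ-φ (known-verts v len₁ i₀)))))) (∈ₚ.∈-tabulate⁺ {f = lookup (Φ S π′)} i)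
      onF : OnFace π′ F
      onF x∈ with ∈ₚ.∈-tabulate⁻ (blocks-coincide (st (colour π′)) us ls uF (Uniqueₚ.tabulate⁺ (Φ-injective st π′)) s⊆F s⊆G blk
                    (Φ-block π′ ∈ₚ.∈-tabulate⁻ (∈ₚ.∈-tabulate⁺ {f = lookup (Φ S π′)})) x∈)
      ... | i , eq = i , trans eq (sym (φ-verts π′ i))

    map-φ-ρ₀ : map φ ρ₀ ≡ σ₀
    map-φ-ρ₀ = trans (sym (Vecₚ.toList-map φ (tabulate (λ i → root (suc i)))))
      (cong toList (trans (sym (Vecₚ.tabulate-∘ φ (λ i → root (suc i)))) (Vecₚ.tabulate∘lookup σ)))

    map-ψ-σ₀ : map ψ σ₀ ≡ ρ₀
    map-ψ-σ₀ = trans (cong (map ψ) (sym map-φ-ρ₀)) (ψφ-list {[]} _ z≤n there)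

    Witnessed : ℕ → (Path → Set) → Set
    Witnessed r′ P = ∃[ π ] (Valid π × length π ≤ r′ × P π)

    -- The path is carried through the induction because `φ` and `ψ` are known to be inverse only on
    -- faces of paths of length at most `suc r`. Each adjacency lengthens it by at most one.
    ball-ψ : ∀ {r′ s} → r′ ≤ r → Ball X d r′ σ₀ s → Witnessed r′ (λ π → OnFace π s) × Ball T d r′ ρ₀ (map ψ s)
    ball-ψ {zero} {s} _ ((_ , u , l) , same) = ([] , _ , z≤n , on)
        , ψ-face {[]} _ z≤n on u l , subst (λ ρ → SameSet T ρ (map ψ s)) map-ψ-σ₀ (same-map ψ same)
      where
      on : OnFace [] s
      on x∈ with ∈-toList⁻ σ (from (same _) x∈)
      ... | i , eq = suc i , trans eq (sym (φ-verts [] (suc i)))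
    ball-ψ {suc r′} r′<r (inj₁ b) with ball-ψ (ℕₚ.<⇒≤ r′<r) b
    ... | (π , v , len , on) , b′ = (π , v , ℕₚ.m≤n⇒m≤1+n len , on) , inj₁ b′
    ball-ψ {suc r′} {s} r′<r (inj₂ (s′ , b , fs′@(_ , us′ , ls′) , (_ , us , ls) , ¬same , τ , fτ@(_ , uτ , lτ) , un))
      with ball-ψ (ℕₚ.<⇒≤ r′<r) b
    ... | (π , v , len , on) , b′ with onFace-complete v len (ℕₚ.<⇒≤ r′<r) on fs′ fτ (from (un _) ∘ inj₁)
    ...   | π′ , v′ , len′ , onτ = (π′ , v′ , len′ , on-s) , inj₂ (map ψ s′ , b′
          , adj-map {X} {T} ψ φ (φψ-list v′ len″ on-s′) (φψ-list v′ len″ on-s)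
              (ψ-face v′ len″ on-s′ us′ ls′) (ψ-face v′ len″ on-s us ls) ¬same (ψ-face v′ len″ onτ uτ lτ) un)
      where
      len″ = ℕₚ.≤-trans len′ (ℕₚ.m≤n⇒m≤1+n r′<r)
      on-s : OnFace π′ s
      on-s = onτ ∘ from (un _) ∘ inj₂
      on-s′ : OnFace π′ s′
      on-s′ = onτ ∘ from (un _) ∘ inj₁

    ball-φ : ∀ {r′ t} → r′ ≤ r → Ball T d r′ ρ₀ t → Witnessed r′ (λ π → InFace π t) × Ball X d r′ σ₀ (map φ t)
    ball-φ {zero} {t} _ ((_ , u , l) , same) = ([] , _ , z≤n , in[])
        , φ-ridge {[]} _ z≤n in[] u l , subst (λ ρ → SameSet X ρ (map φ t)) map-φ-ρ₀ (same-map φ same)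
      where
      in[] : InFace [] t
      in[] = there ∘ from (same _)
    ball-φ {suc r′} r′<r (inj₁ b) with ball-φ (ℕₚ.<⇒≤ r′<r) b
    ... | (π , v , len , sub) , b′ = (π , v , ℕₚ.m≤n⇒m≤1+n len , sub) , inj₁ b′
    ball-φ {suc r′} {t} r′<r (inj₂ (t′ , b , (_ , ut′ , lt′) , (_ , ut , lt) , ¬same , τ , ((_ , π′ , v′ , subτ) , uτ , lτ) , un))
      with ball-φ (ℕₚ.<⇒≤ r′<r) b
    ... | (π , v , len , sub) , b′ = (π′ , v′ , len′ , sub-t) , inj₂ (map φ t′ , b′
          , adj-map {T} {X} φ ψ (ψφ-list v′ len″ sub-t′) (ψφ-list v′ len″ sub-t)
              (φ-ridge v′ len″ sub-t′ ut′ lt′) (φ-ridge v′ len″ sub-t ut lt) ¬same (φ-face v′ len″ (subτ _) uτ lτ) un)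
      where
      sub-t : InFace π′ t
      sub-t = subτ _ ∘ from (un _) ∘ inj₂
      sub-t′ : InFace π′ t′
      sub-t′ = subτ _ ∘ from (un _) ∘ inj₁
      -- The path `π′` that witnesses the face `τ` comes with no bound on its length. The bound is
      -- read off the depths of the vertices of the ridge `t′`, which also lies on the short path
      -- `π`.
      len′ : length π′ ≤ suc r′
      len′ = ridge-depth v′ ut′ lt′ sub-t′ (λ w∈ → inFace-depth {π} len sub w∈)
      len″ : length π′ ≤ suc r
      len″ = ℕₚ.≤-trans len′ (ℕₚ.m≤n⇒m≤1+n r′<r)

    Y Z : Cx
    Y = Nbr X d r σ₀
    Z = Nbr T d r ρ₀

    -- The round trip is returned with the face: on singletons it says that `φ` inverts `ψ` at every
    -- vertex of `Y`.
    nbr-ψ : ∀ {s} → Face Y s → Face Z (map ψ s) × map φ (map ψ s) ≡ s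
    nbr-ψ {s} (inj₁ ((_ , u , l) , b)) with ball-ψ ℕₚ.≤-refl b
    ... | (π , v , len , on) , b′ = inj₁ (ψ-face v len′ on u l , b′) , φψ-list v len′ on
      where len′ = ℕₚ.m≤n⇒m≤1+n len
    nbr-ψ {[]} (inj₂ (inj₁ ((_ , _ , ()) , _)))
    -- Deleting the head gives one ridge of the `d`-face. It is in the ball, hence on a path of
    -- length at most `r`, and `onFace-complete` puts the whole face on a path of length at most
    -- `suc r`.
    nbr-ψ {x ∷ l} (inj₂ (inj₁ (fs@(_ , u@(_ ∷ u′) , len-s) , ridges))) with ball-ψ ℕₚ.≤-refl (ridges l fl (λ _ → there))
      where
      len-l = ℕₚ.suc-injective len-s
      fl : FaceCard X d l
      fl = (u′ , inj₁ (ℕₚ.≤-reflexive len-l)) , u′ , len-l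
    ... | (π , v , len , on) , _
      with onFace-complete v len ℕₚ.≤-refl on ((u′ , inj₁ (ℕₚ.≤-reflexive (ℕₚ.suc-injective len-s))) , u′ , ℕₚ.suc-injective len-s) fs there
    ...   | π′ , v′ , len′ , onF = inj₂ (inj₁ (ψ-face v′ len′ onF u len-s , ridges′)) , φψ-list v′ len′ onF
      where
      ridges′ : ∀ ρ → FaceCard T d ρ → (∀ w → w ∈ ρ → w ∈ map ψ (x ∷ l)) → Ball T d r ρ₀ ρ
      ridges′ ρ (_ , uρ , lρ) ρ⊆ = subst (Ball T d r ρ₀) (ψφ-list v′ len′ inF) (proj₂ (ball-ψ ℕₚ.≤-refl
          (ridges (map φ ρ) (φ-ridge v′ len′ inF uρ lρ)
            (λ y y∈ → subst (y ∈_) (φψ-list v′ len′ onF) (map-⊆ φ (ρ⊆ _) y∈)))))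
        where
        inF : InFace π′ ρ
        inF = onFace⇒inFace v′ len′ onF ∘ ρ⊆ _
    nbr-ψ {s} (inj₂ (inj₂ (_ , u , lt , σ′ , b , s⊆))) with ball-ψ ℕₚ.≤-refl b
    ... | (π , v , len , on) , b′ = inj₂ (inj₂ (proj₁ fs , proj₁ (proj₂ fs) , subst (_< d) (sym (Listₚ.length-map ψ s)) lt
          , map ψ σ′ , b′ , λ _ → map-⊆ ψ (s⊆ _))) , φψ-list v len′ on-s
      where
      len′ = ℕₚ.m≤n⇒m≤1+n len
      on-s : OnFace π s
      on-s = on ∘ s⊆ _
      fs = ψ-face {π} v len′ on-s u refl

    nbr-φ : ∀ {t} → Face Z t → Face Y (map φ t) × map ψ (map φ t) ≡ t
    nbr-φ {t} (inj₁ ((_ , u , l) , b)) with ball-φ ℕₚ.≤-refl b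
    ... | (π , v , len , sub) , b′ = inj₁ (φ-ridge v len′ sub u l , b′) , ψφ-list v len′ sub
      where len′ = ℕₚ.m≤n⇒m≤1+n len
    nbr-φ {[]} (inj₂ (inj₁ ((_ , _ , ()) , _)))
    nbr-φ {w ∷ l} (inj₂ (inj₁ (((_ , π′ , v′ , sub′) , u@(_ ∷ u′) , len-t) , ridges)))
      with ball-φ ℕₚ.≤-refl (ridges l ((u′ , π′ , v′ , λ x → sub′ x ∘ there) , u′ , ℕₚ.suc-injective len-t) (λ _ → there))
    ... | (π , v , len , sub) , _ = inj₂ (inj₁ (φ-face v′ len′ (sub′ _) u len-t , ridges′)) , ψφ-list v′ len′ (sub′ _)
      where
      len′ : length π′ ≤ suc r
      len′ = ridge-depth v′ u′ (ℕₚ.suc-injective len-t) (sub′ _ ∘ there) (λ w∈ → inFace-depth {π} len sub w∈)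
      ridges′ : ∀ ρ → FaceCard X d ρ → (∀ x → x ∈ ρ → x ∈ map φ (w ∷ l)) → Ball X d r σ₀ ρ
      ridges′ ρ (_ , uρ , lρ) ρ⊆ = subst (Ball X d r σ₀) (φψ-list v′ len′ onF) (proj₂ (ball-φ ℕₚ.≤-refl
          (ridges (map ψ ρ) (ψ-face v′ len′ onF uρ lρ)
            (λ y y∈ → subst (y ∈_) (ψφ-list v′ len′ (sub′ _)) (map-⊆ ψ (ρ⊆ _) y∈)))))
        where
        onF : OnFace π′ ρ
        onF = inFace⇒onFace {π′} (sub′ _) ∘ ρ⊆ _
    nbr-φ {t} (inj₂ (inj₂ (_ , u , lt , ρ , b , t⊆))) with ball-φ ℕₚ.≤-refl b
    ... | (π , v , len , sub) , b′ = inj₂ (inj₂ ((u′ , inj₁ (ℕₚ.<⇒≤ lt′)) , u′ , lt′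
          , map φ ρ , b′ , λ _ → map-⊆ φ (t⊆ _))) , ψφ-list v len′ (sub ∘ t⊆ _)
      where
      len′ = ℕₚ.m≤n⇒m≤1+n len
      u′ = φ-unique v len′ (sub ∘ t⊆ _) u
      lt′ = subst (_< d) (sym (Listₚ.length-map φ t)) lt

    isomorphism : Y ≅ Z
    isomorphism = ψ , φ
      , (λ v fv → proj₁ (nbr-ψ fv) , Listₚ.∷-injectiveˡ (proj₂ (nbr-ψ fv)))
      , (λ w fw → proj₁ (nbr-φ fw) , Listₚ.∷-injectiveˡ (proj₂ (nbr-φ fw)))
      -- In the converse `nbr-φ` only gives a face on `map φ (map ψ s)`; this is `s`, because every
      -- entry of `s` is a vertex of `Y`.
      , λ s vs → mk⇔ (proj₁ ∘ nbr-ψ) (λ fs → subst (Face Y) (fixed vs) (proj₁ (nbr-φ fs)))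
      where
      fixed : ∀ {s} → All (λ v → Face Y (v ∷ [])) s → map φ (map ψ s) ≡ s
      fixed [] = refl
      fixed (fv ∷ vs) = cong₂ _∷_ (Listₚ.∷-injectiveˡ (proj₂ (nbr-ψ fv))) (fixed vs)

-- Tuples of systems as the sample space.

module _ {A : Set} where

  tuples : List A → ∀ k → List (Vec A k)
  tuples xs zero = Vec.[] ∷ []
  tuples xs (suc k) = cartesianProductWith Vec._∷_ xs (tuples xs k)

  length-tuples : ∀ xs k → length (tuples xs k) ≡ length xs ^ k
  length-tuples xs zero = refl
  length-tuples xs (suc k) = trans (go xs) (cong (length xs *_) (length-tuples xs k))
    where
    go : ∀ ys → length (cartesianProductWith Vec._∷_ ys (tuples xs k)) ≡ length ys * length (tuples xs k)
    go [] = refl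
    go (y ∷ ys) = trans (Listₚ.length-++ (map (y Vec.∷_) (tuples xs k)))
      (cong₂ _+_ (Listₚ.length-map (y Vec.∷_) (tuples xs k)) (go ys))

  ∈-tuples⁺ : ∀ {xs k} {v : Vec A k} → (∀ i → lookup v i ∈ xs) → v ∈ tuples xs k
  ∈-tuples⁺ {v = Vec.[]} _ = here refl
  ∈-tuples⁺ {v = x Vec.∷ v} h = ∈ₚ.∈-cartesianProductWith⁺ Vec._∷_ (h zero) (∈-tuples⁺ (λ i → h (suc i)))

  ∈-tuples⁻ : ∀ {xs k} {v : Vec A k} → v ∈ tuples xs k → ∀ i → lookup v i ∈ xs
  ∈-tuples⁻ {xs} {suc k} v∈ i with ∈ₚ.∈-cartesianProductWith⁻ Vec._∷_ xs (tuples xs k) v∈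
  ∈-tuples⁻ {xs} {suc k} v∈ zero | x , w , x∈ , w∈ , refl = x∈
  ∈-tuples⁻ {xs} {suc k} v∈ (suc i) | x , w , x∈ , w∈ , refl = ∈-tuples⁻ w∈ i

  tuples-unique : ∀ {xs} → Unique xs → ∀ k → Unique (tuples xs k)
  tuples-unique u zero = [] ∷ []
  tuples-unique u (suc k) = Uniqueₚ.cartesianProductWith⁺ Vec._∷_ Vecₚ.∷-injective u (tuples-unique u k)

  unique-toList⇒injective : ∀ {m} (v : Vec A m) → Unique (toList v) → ∀ {i j} → lookup v i ≡ lookup v j → i ≡ j
  unique-toList⇒injective (x Vec.∷ v) u {zero} {zero} _ = refl
  unique-toList⇒injective (x Vec.∷ v) u {zero} {suc j} eq =
    contradiction (subst (_∈ toList v) (sym eq) (∈-toList⁺ v j)) (Uniqueₚ.Unique[x∷xs]⇒x∉xs u)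
  unique-toList⇒injective (x Vec.∷ v) u {suc i} {zero} eq =
    contradiction (subst (_∈ toList v) eq (∈-toList⁺ v i)) (Uniqueₚ.Unique[x∷xs]⇒x∉xs u)
  unique-toList⇒injective (x Vec.∷ v) (_ ∷ u) {suc i} {suc j} eq = cong suc (unique-toList⇒injective v u eq)

  as-vector : ∀ {m} (l : List A) → length l ≡ m → ∃[ v ] toList {n = m} v ≡ l
  as-vector l refl = Vec.fromList l , Vecₚ.toList∘fromList l

-- Dividing by `suc c`, with `c` rounded up to `suc c` in the error term, leaves `suc m * W` ≤
-- `suc m * g + W`. So `suc m * suc c` unseen vertices suffice for an error of at most one part in
-- `suc m`.
mostly-good : ∀ m c W g → suc m * suc c * W ≤ suc m * suc c * g + c * W → m * W ≤ suc m * g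
mostly-good m c W g le = ℕₚ.+-cancelˡ-≤ W (m * W) (suc m * g) (ℕₚ.*-cancelˡ-≤ (suc c) (begin
    suc c * (suc m * W)               ≡⟨ swap W ⟩
    suc m * suc c * W                 ≤⟨ le ⟩
    suc m * suc c * g + c * W         ≤⟨ ℕₚ.+-monoʳ-≤ (suc m * suc c * g) (ℕₚ.*-monoˡ-≤ W (ℕₚ.n≤1+n c)) ⟩
    suc m * suc c * g + suc c * W     ≡⟨ cong (_+ suc c * W) (sym (swap g)) ⟩
    suc c * (suc m * g) + suc c * W   ≡⟨ sym (ℕₚ.*-distribˡ-+ (suc c) (suc m * g) W) ⟩
    suc c * (suc m * g + W)           ≡⟨ cong (suc c *_) (ℕₚ.+-comm (suc m * g) W) ⟩
    suc c * (W + suc m * g)           ∎))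
  where
  open ℕₚ.≤-Reasoning
  swap : ∀ x → suc c * (suc m * x) ≡ suc m * suc c * x
  swap x = trans (sym (ℕₚ.*-assoc (suc c) (suc m) x)) (cong (_* x) (ℕₚ.*-comm (suc c) (suc m)))

-- From the count to the limit.

module _ (d k : ℕ) where

  open Paths (suc d) k

  private
    systems : ∀ n → List (Family n)
    systems n = filterᵇ (isSteiner (suc d)) (allFamilies n)

    systems-steiner : ∀ {n} {S : Vec (Family n) (suc k)} → S ∈ tuples (systems n) (suc k) → ∀ j → Steiner (suc d) (lookup S j)
    systems-steiner {n} S∈ j = isSteiner⇒Steiner (∈-filterᵇ⁻ {p = isSteiner (suc d)} (allFamilies n) (∈-tuples⁻ {xs = systems n} S∈ j))

  MostlyIsomorphic : ∀ n → ℕ → ℕ → List (Fin n) → Set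
  MostlyIsomorphic n r m σ = Σ (List (Vec (Family n) (suc k))) λ L → Unique L
    × All (λ S → VAll.All (λ F → isSteiner (suc d) F ≡ true) S
                 × (Nbr (SteinerCx (suc d) S) (suc d) r σ ≅ Tball (suc d) (suc k) r)) L
    × m * numSteiner (suc d) n ^ suc k ≤ suc m * length L

  mostly-isomorphic : ∀ r m {E} → Explored E → (∀ {π} → Valid π → length π ≤ suc r → π ∈ E) →
    ∀ n → suc m * suc (cost E) + (suc d + length E) ≤ n → (σ : Vec (Fin n) (suc d)) → Unique (toList σ) →
    MostlyIsomorphic n r m (toList σ)
  mostly-isomorphic r m {E} ex cover n le σ u with many-good {suc m * suc (cost E)} ex le
    where
    U : List (Vec (Family n) (suc k))
    U = tuples (systems n) (suc k)
    -- The default vertex of `ext` is taken from the ridge, which is nonempty since its size is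
    -- `suc d`.
    open Counting (suc d) k n (lookup σ zero) σ (unique-toList⇒injective σ u) U systems-steiner
      (λ st → ∈-tuples⁺ {xs = systems n} λ j → ∈-filterᵇ⁺ {p = isSteiner (suc d)} (allFamilies-complete _) (Steiner⇒isSteiner (st j)))
      (tuples-unique {xs = systems n} (Uniqueₚ.filter⁺ _ (allFamilies-unique n)) (suc k))
  ... | L , uL , good , bound = L , uL
      , All.tabulate (λ S∈ → VAllₚ.lookup⁻ (λ j → Steiner⇒isSteiner (steiner S∈ j))
          , isomorphism cover (steiner S∈) (proj₂ (good S∈)))
      , mostly-good m (cost E) _ (length L) (subst (λ W → suc m * suc (cost E) * W ≤ suc m * suc (cost E) * length L + cost E * W)
          (length-tuples (systems n) (suc k)) bound)
    where
    open Isomorphism (suc d) k n (lookup σ zero) σ (unique-toList⇒injective σ u) r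
    steiner : ∀ {S} → S ∈ L → ∀ j → Steiner (suc d) (lookup S j)
    steiner S∈ = systems-steiner (proj₁ (good S∈))

  mostly-isomorphic-list : ∀ r m {E} → Explored E → (∀ {π} → Valid π → length π ≤ suc r → π ∈ E) →
    ∀ n → suc m * suc (cost E) + (suc d + length E) ≤ n → (σ : List (Fin n)) → Unique σ → length σ ≡ suc d →
    MostlyIsomorphic n r m σ
  mostly-isomorphic-list r m ex cover n le σ u len with as-vector σ len
  ... | v , refl = mostly-isomorphic r m ex cover n le v u

theorem2p3 : (d k : ℕ) → 1 ≤ d → 1 ≤ k
    → (n : ℕ → ℕ) → (∀ i → Admissible d (n i))
    → (∀ M → ∃[ I ] (∀ i → I ≤ i → M ≤ n i))
    → (σ : (i : ℕ) → List (Fin (n i)))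
    → (∀ i → Unique (σ i) × length (σ i) ≡ d)
    → ∀ (r : ℕ) (m : ℕ) → 1 ≤ m
    → ∃[ I ] (∀ i → I ≤ i →
        Σ (List (Vec (Family (n i)) k)) λ L →
          Unique L
          × All (λ S → VAll.All (λ F → isSteiner d F ≡ true) S
                       × (Nbr (SteinerCx d S) d r (σ i) ≅ Tball d k r)) L
          × (m ∸ 1) * numSteiner d (n i) ^ k ≤ m * length L)
theorem2p3 (suc d) (suc k) _ _ n _ n→∞ σ σ-ridge r (suc m) _ with Paths.explore-ball (suc d) k (suc r)
-- Ridges of the ball lie on paths of length at most `r`, and the `d`-faces of the neighbourhood on
-- paths of length at most `suc r`, hence the radius of the exploration. The threshold for n leaves
-- `suc m * suc (cost E)` vertices besides the `suc d` of the ridge and one for each explored path.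
... | E , ex , cover with n→∞ (suc m * suc (Paths.cost (suc d) k E) + (suc d + length E))
...   | I , large = I , λ i I≤i →
  mostly-isomorphic-list d k r m ex cover (n i) (large i I≤i) (σ i) (proj₁ (σ-ridge i)) (proj₂ (σ-ridge i))
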